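{- There is no edge-girth-regular graph with parameters $(v,3,7,6)$; that is, for every positive integer $v$, no $egr(v,3,7,6)$-graph exists.
   Context: Graphs are finite, simple and undirected. For integers $v,k,g,\lambda$, an $egr(v,k,g,\lambda)$-graph (edge-girth-regular graph) is a $k$-regular graph on $v$ vertices with girth $g$ (the length of a shortest cycle is exactly $g$) such that every edge is contained in exactly $\lambda$ cycles of length $g$. -}

module Defs where

open import Data.Fin.Base using (Fin)
open import Data.List.Base as List using (List)
open import Data.Nat.Base using (ℕ; _≤_; _<_)
open import Data.Product.Base using (Σ-syntax; ∃-syntax; _×_; _,_; uncurry; proj₁)
open import Data.Sum.Base using (_⊎_)
open import Data.Vec.Base using (Vec; []; _∷_; _∷ʳ_; zip)
open import Data.Vec.Membership.Propositional using (_∈_)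
open import Data.Vec.Relation.Unary.All using (All)
open import Data.Vec.Relation.Unary.Unique.Propositional using (Unique)
open import Function.Bundles using (Inverse; _⇔_)
import Function.Properties.Equivalence as ⇔
open import Level using (0ℓ)
open import Relation.Binary.Bundles using (Setoid)
open import Relation.Binary.Definitions using (Decidable; Irreflexive; Symmetric)
open import Relation.Binary.PropositionalEquality using (_≡_; setoid)
open import Relation.Nullary.Negation.Core using (¬_)

record Graph (v : ℕ) : Set₁ where
  field
    Adj    : Fin v → Fin v → Set
    adj?   : Decidable Adj
    irrefl : Irreflexive _≡_ Adj
    sym    : Symmetric Adj

  neighbours : Fin v → List (Fin v)
  neighbours x = List.filter (adj? x) (List.allFin v)

  degree : Fin v → ℕ
  degree x = List.length (neighbours x)

rotate : ∀ {A : Set} {n} → Vec A n → Vec A n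
rotate []       = []
rotate (x ∷ xs) = xs ∷ʳ x

-- The cyclically consecutive pairs of x₁ , … , xₙ, that is
-- (x₁ , x₂) , … , (xₙ₋₁ , xₙ) , (xₙ , x₁).
steps : ∀ {A : Set} {n} → Vec A n → Vec (A × A) n
steps xs = zip xs (rotate xs)

record IsCycle {v} (G : Graph v) {n} (xs : Vec (Fin v) n) : Set where
  open Graph G
  field
    3≤length : 3 ≤ n
    distinct : Unique xs
    adjacent : All (uncurry Adj) (steps xs)

HasEdge : ∀ {v n} → Vec (Fin v) n → Fin v → Fin v → Set
HasEdge xs x y = (x , y) ∈ steps xs ⊎ (y , x) ∈ steps xs

-- A cycle is a subgraph, so vertex sequences differing only in starting point
-- or direction represent the same cycle: cycles are compared by their edge
-- sets (which determine their vertex sets).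
SameEdges : ∀ {v n} → Vec (Fin v) n → Vec (Fin v) n → Set
SameEdges xs ys = ∀ x y → HasEdge xs x y ⇔ HasEdge ys x y

cyclesThrough : ∀ {v} → Graph v → ℕ → Fin v → Fin v → Setoid 0ℓ 0ℓ
cyclesThrough {v} G n x y = record
  { Carrier       = Σ[ xs ∈ Vec (Fin v) n ] (IsCycle G xs × HasEdge xs x y)
  ; _≈_           = λ c d → SameEdges (proj₁ c) (proj₁ d)
  ; isEquivalence = record
    { refl  = λ _ _ → ⇔.refl
    ; sym   = λ p a b → ⇔.sym (p a b)
    ; trans = λ p q a b → ⇔.trans (p a b) (q a b)
    }
  }

HasCycle : ∀ {v} → Graph v → ℕ → Set
HasCycle {v} G n = Σ[ xs ∈ Vec (Fin v) n ] IsCycle G xs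

HasGirth : ∀ {v} → Graph v → ℕ → Set
HasGirth G g = HasCycle G g × (∀ {n} → n < g → ¬ HasCycle G n)

IsRegular : ∀ {v} → Graph v → ℕ → Set
IsRegular G k = ∀ x → Graph.degree G x ≡ k

record IsEdgeGirthRegular {v} (G : Graph v) (k g l : ℕ) : Set where
  open Graph G
  field
    regular       : IsRegular G k
    girth         : HasGirth G g
    cyclesPerEdge : ∀ {x y} → Adj x y → Inverse (setoid (Fin l)) (cyclesThrough G g x y)

EGR : (v k g l : ℕ) → Set₁
EGR v k g l = ∃[ G ] IsEdgeGirthRegular {v} G k g l

{-# OPTIONS --safe #-}
module Submission where

-- Call a path of length 4 good if it lies on a heptagon; girth 7 makes this heptagon
-- unique, so an edge uv lies on as many heptagons as there are good paths x u v w y.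
-- If this number is 6 for every edge, then adding up over the three edges at v shows
-- that for each path u v w exactly 3 of the 4 paths x u v w y are good. Call a path
-- x u v w straight if it extends to a path x u v w y which is not good. Straightness
-- is invariant under reversal, every path u v w has exactly one straight extension at
-- either end, and a path of length 4 is good unless both of its subpaths of length 3 are
-- straight. The graph thus looks locally like a cubic map whose faces are followed by
-- the straight paths: PGL₂(ℤ) acts on the flags of the graph, heptagons correspond to
-- elements fixing a flag, and such elements cannot be short in the generators nor
-- turn three times in a row in the same direction. On the other hand every good path
-- yields such an element, so that a finite case analysis, in which one multiplies the
-- elements already known to fix a flag, ends in contradictions. First it excludes that
-- a heptagon turns right, left, right, left; the remaining possibilities are few.

open import Defs
open import Data.Bool.Base using (Bool; true; false; T; not; _∧_; _∨_; if_then_else_)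
open import Data.Bool.ListAction using (any)
open import Data.Bool.Properties using (T-≡; T-∧; T-∨; T-irrelevant)
open import Data.Empty using (⊥)
open import Data.Fin.Base using (Fin; zero)
open import Data.Fin.Permutation using (↔⇒≡)
open import Data.Fin.Properties using (_≟_; any?; +↔⊎)
open import Data.List.Base as List using (List; []; _∷_; _++_; foldr; map; concatMap; cartesianProductWith; length; iterate)
import Data.List.Membership.Propositional as List
import Data.List.Membership.Propositional.Properties as List
open import Data.List.Relation.Unary.All as ListAll using ([]; _∷_)
import Data.List.Relation.Unary.All.Properties as ListAll
open import Data.List.Relation.Unary.AllPairs using ([]; _∷_)
import Data.List.Relation.Unary.Any as List using (here; there)
import Data.List.Relation.Unary.Unique.Propositional as List
import Data.List.Relation.Unary.Unique.Propositional.Properties as List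
open import Data.Maybe.Base as Maybe using (Maybe; just; nothing; maybe)
open import Data.Nat.Base using (ℕ; zero; suc; _+_; _*_; _≤_; _<_; z≤n; s≤s; _<ᵇ_; _≡ᵇ_; NonZero)
open import Data.Nat.Properties using (≤-trans; ≤-pred; n≤1+n; _≤?_; <ᵇ⇒<; ≡ᵇ⇒≡; +-comm; *-cancelˡ-≡; +-cancelʳ-≡)
open import Data.Nat.Tactic.RingSolver using (solve-∀)
open import Data.Product.Base using (Σ; Σ-syntax; ∃; ∃₂; _×_; _,_; uncurry; proj₁; proj₂)
open import Data.Sum.Base as Sum using (_⊎_; inj₁; inj₂; [_,_])
open import Data.Sum.Function.Propositional using (_⊎-↔_)
open import Data.Unit.Base using (⊤; tt)
open import Data.Vec.Base using (Vec; []; _∷_; _∷ʳ_; zip; initLast)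
open import Data.Vec.Membership.Propositional using (_∈_)
open import Data.Vec.Relation.Unary.All as All using (All; []; _∷_)
open import Data.Vec.Relation.Unary.AllPairs using ([]; _∷_)
open import Data.Vec.Relation.Unary.Any using (here; there)
open import Data.Vec.Relation.Unary.Unique.Propositional using (Unique)
open import Function.Base using (_∘_; id)
open import Function.Bundles using (_↔_; mk↔ₛ′; Inverse; _⇔_; mk⇔; Equivalence)
import Function.Properties.Equivalence as ⇔
open import Function.Properties.Inverse using (↔-trans; ↔-sym)
open import Relation.Binary.Bundles using (Setoid)
open import Relation.Binary.PropositionalEquality hiding (setoid; [_])
open import Relation.Nullary.Decidable
  using (Dec; yes; no; ⌊_⌋; _×-dec_; ¬?; True; toWitness; fromWitness; recompute; decidable-stable)
open import Relation.Nullary.Negation.Core using (¬_; contradiction)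

open Equivalence using (to)

-- Words acting on flags

data Turn : Set where
  left right : Turn

opposite : Turn → Turn
opposite left  = right
opposite right = left

data Letter : Set where
  cross  : Letter
  turn   : Turn → Letter
  mirror : Letter

Word : Set
Word = List Letter

-- Conjugation by `mirror` takes every letter to its inverse, so one function serves both to pass a
-- letter through `mirror` and to invert it.
reflect : Letter → Letter
reflect (turn t) = turn (opposite t)
reflect x        = x

-- Normal forms in PGL₂(ℤ) = ⟨ cross , turn left , mirror ⟩: mirror commutes with
-- cross and inverts turns, so it is moved to the front; the rest is the free product
-- of ⟨ cross ⟩ of order 2 and ⟨ turn left ⟩ of order 3. Words act from left to right.
push : Letter → Word → Word
push mirror       (mirror ∷ w)       = w
push mirror       w                  = mirror ∷ w
push cross        (mirror ∷ w)       = mirror ∷ push cross w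
push cross        (cross ∷ w)        = w
push cross        w                  = cross ∷ w
push (turn t)     (mirror ∷ w)       = mirror ∷ push (turn (opposite t)) w
push (turn left)  (turn left ∷ w)    = turn right ∷ w
push (turn left)  (turn right ∷ w)   = w
push (turn right) (turn left ∷ w)    = w
push (turn right) (turn right ∷ w)   = turn left ∷ w
push (turn t)     w                  = turn t ∷ w

infixr 6 _·_
_·_ : Word → Word → Word
u · w = foldr push w u

inverseOnto : Word → Word → Word
inverseOnto acc []       = acc
inverseOnto acc (x ∷ w)  = inverseOnto (push (reflect x) acc) w

inverse : Word → Word
inverse = inverseOnto []

shift : Word → Word
shift []                = []
shift (mirror ∷ [])     = mirror ∷ []
shift (mirror ∷ x ∷ w)  = (mirror ∷ w) · (reflect x ∷ [])
shift (x ∷ w)           = w · (x ∷ [])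

-- Each turn is one step of a walk: cross the current edge, then rotate about the new vertex to
-- choose the next edge.
route : List Turn → Word
route []       = []
route (t ∷ ts) = cross ∷ turn t ∷ route ts

turns : Word → Maybe (List Turn)
turns []                   = just []
turns (cross ∷ turn t ∷ w) = Maybe.map (t ∷_) (turns w)
turns _                    = nothing

same : Turn → Turn → Bool
same left  left  = true
same right right = true
same _     _     = false

-- Three equal turns follow a path of length 4 both of whose subpaths of length 3 are straight, that
-- is, a path which is not good. Only the first turns are inspected; other starting points are
-- reached by `shift`.
straight : List Turn → Bool
straight (t₁ ∷ t₂ ∷ t₃ ∷ _) = same t₁ t₂ ∧ same t₂ t₃
straight _ = false

zigzag : List Turn → Bool
zigzag (t₁ ∷ t₂ ∷ t₃ ∷ t₄ ∷ _) = not (same t₁ t₂) ∧ not (same t₂ t₃) ∧ not (same t₃ t₄)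
zigzag _ = false

Node : Set
Node = Word × Turn × Turn × Turn

everyTurns : ℕ → (List Turn → Bool) → Bool
everyTurns zero    f = f []
everyTurns (suc n) f = everyTurns n (f ∘ (left ∷_)) ∧ everyTurns n (f ∘ (right ∷_))

-- A walk round a heptagon returns to its first directed edge, hence to the initial flag or to its
-- mirror image.
bothClosures : (Word → Bool) → List Turn → Bool
bothClosures f ts = f (route ts) ∧ f (route ts ++ mirror ∷ [])

-- The words in gs fix a common flag p. Each node (u , t₁ , t₂ , t₃) of a plan selects the
-- heptagon which starts at the flag run u p with the turns t₁ , t₂ , t₃, and the
-- case analysis is over its remaining turns. A case is closed if some product of
-- at most three of the known words or their inverses is conjugate to an illegal word.
module Check (forbidden : List Turn → Bool) where

  -- Fewer than seven turns would return to a vertex too soon for girth 7; seven turns trace a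
  -- heptagon, whose shape may be excluded.
  illegalTurns : List Turn → Bool
  illegalTurns [] = false
  illegalTurns ts@(_ ∷ _) = (length ts <ᵇ 7) ∨ ((length ts ≡ᵇ 7) ∧ forbidden ts)

  unmirrored : Word → Bool
  unmirrored (turn _ ∷ []) = true
  unmirrored (cross ∷ [])  = true
  unmirrored w             = maybe illegalTurns false (turns w)

  illegal : Word → Bool
  -- The identity fixes every flag, so the empty word must not close a case.
  illegal []             = false
  illegal (mirror ∷ [])  = true
  illegal (mirror ∷ w)   = unmirrored w
  illegal w              = unmirrored w

  -- Cyclic reduction. Intermediate words are passed as arguments, here and below, so
  -- that the type checker evaluates them only once.
  settle : ℕ → Word → Word
  settleAt : ℕ → Word → Word → Word
  settle zero    w = w
  settle (suc n) w = settleAt n w (shift (shift (shift (shift w))))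
  settleAt n w w′ = if length w′ <ᵇ length w then settle n w′ else w

  -- A word with at most seven crosses has length at most 15, including a mirror.
  shiftIllegal : ℕ → Word → Bool
  shiftIllegal n w = (length w <ᵇ 17) ∧ any illegal (iterate shift w n)

  conjugateIllegal : ℕ → ℕ → Word → Bool
  conjugateIllegal m n w = shiftIllegal n (settle m w)

  generators : List Word → List Word
  generators = concatMap λ h → h ∷ inverse h ∷ []

  -- Up to conjugation and inversion, a product involving `g` begins with `g`; products without it
  -- were tried when the earlier words were added.
  productsBy : List Word → Word → List Word
  productsBy gens g = g ∷ two ++ cartesianProductWith _·_ two gens
    where two = cartesianProductWith _·_ (g ∷ []) gens

  contradictory : Word → List Word → Bool
  -- At most forty rounds of reduction; sixteen shifts then cover all rotations of a word of length
  -- at most 16.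
  contradictory g gs = any (conjugateIllegal 40 16) (productsBy (generators (g ∷ gs)) g)

  conjugate : Word → Word → Word
  conjugate u w = u · w · inverse u

  refutes : List Node → List Word → Bool
  extends : List Node → List Word → Word → Bool
  refutes []                          gs = false
  -- Three turns that are not all equal follow a good path, so the selected heptagon exists; its
  -- last four turns and its closure remain open.
  refutes ((u , t₁ , t₂ , t₃) ∷ plan) gs = not (straight (t₁ ∷ t₂ ∷ t₃ ∷ [])) ∧
    everyTurns 4 λ ts → bothClosures (λ w → extends plan gs (conjugate u w)) (t₁ ∷ t₂ ∷ t₃ ∷ ts)
  extends plan gs g = contradictory g gs ∨ refutes plan (g ∷ gs)

-- Plans and forbidden heptagons

refuted : List Node → Word → Bool
refuted plan = Check.extends straight plan []

-- Zigzags are refuted first, with only straight turns forbidden; afterwards they may be forbidden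
-- as well.
straightOrZigzag : List Turn → Bool
straightOrZigzag ts = straight ts ∨ zigzag ts

-- One handedness suffices, since `mirror` exchanges it with the other.
rightZigzag : List Turn → Word
rightZigzag ts = route (right ∷ left ∷ right ∷ left ∷ ts)

-- The plans were found by computer search; the Boolean tells
-- whether the heptagon closes up with a mirror.
zigzagPlan : List Turn → Bool → List Node
zigzagPlan (right ∷ right ∷ left ∷ []) false =
  ([] , right , right , left) ∷ (turn right ∷ cross ∷ turn left ∷ cross ∷ [] , left , left , right) ∷ []
zigzagPlan (right ∷ right ∷ left ∷ []) true =
  (cross ∷ turn right ∷ [] , left , right , right) ∷ ([] , left , left , right) ∷ []
zigzagPlan (right ∷ left ∷ right ∷ []) false =
  (turn left ∷ [] , right , left , left) ∷ (cross ∷ [] , right , right , left) ∷ []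
zigzagPlan (right ∷ left ∷ right ∷ []) true =
  ([] , right , right , left) ∷ (turn right ∷ cross ∷ turn left ∷ [] , right , left , left) ∷
  ([] , right , left , left) ∷ (turn right ∷ [] , left , right , right) ∷ []
zigzagPlan (left ∷ right ∷ left ∷ []) false =
  (cross ∷ [] , right , left , left) ∷ (cross ∷ turn right ∷ [] , left , right , right) ∷ []
zigzagPlan (left ∷ right ∷ left ∷ []) true =
  (cross ∷ turn right ∷ [] , left , right , right) ∷ ([] , left , left , right) ∷ []
zigzagPlan _ _ =
  ([] , right , left , left) ∷ (turn right ∷ cross ∷ [] , right , right , left) ∷ []

zigzagRefuted : List Turn → Bool
zigzagRefuted ts = refuted (zigzagPlan ts false) (rightZigzag ts) ∧ refuted (zigzagPlan ts true) (rightZigzag ts ++ mirror ∷ [])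

-- With zigzags forbidden, a heptagon beginning right, left, right must turn right next. The second
-- node selects a heptagon from the other end of the same edge.
finalPlan : List Node
finalPlan = ([] , right , left , right) ∷ (cross ∷ [] , left , right , left) ∷ []

abstract

  -- Evaluation settles all eight ways to complete the four alternating turns, each with both
  -- closures.
  zigzags-refuted : everyTurns 3 zigzagRefuted ≡ true
  zigzags-refuted = refl

  finalPlan-refutes : Check.refutes straightOrZigzag finalPlan [] ≡ true
  finalPlan-refutes = refl

-- Soundness of the case analysis for an abstract action

any-sound : ∀ {A : Set} {P : A → Set} (f : A → Bool) → (∀ x → P x → T (f x) → ⊥) →
            ∀ xs → ListAll.All P xs → T (any f xs) → ⊥
any-sound f sound (x ∷ xs) (px ∷ pxs) t with f x in eq
... | true  = sound x px (subst T (sym eq) tt)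
... | false = any-sound f sound xs pxs t

everyTurns-sound : ∀ n f ts → length ts ≡ n → T (everyTurns n f) → T (f ts)
everyTurns-sound zero    f []           _    every = every
everyTurns-sound (suc n) f (left  ∷ ts) refl every = everyTurns-sound n (f ∘ (left ∷_)) ts refl
  (proj₁ (to (T-∧ {everyTurns n (f ∘ (left ∷_))} {everyTurns n (f ∘ (right ∷_))}) every))
everyTurns-sound (suc n) f (right ∷ ts) refl every = everyTurns-sound n (f ∘ (right ∷_)) ts refl
  (proj₂ (to (T-∧ {everyTurns n (f ∘ (left ∷_))} {everyTurns n (f ∘ (right ∷_))}) every))

everyTurns-true : ∀ n f ts → length ts ≡ n → everyTurns n f ≡ true → T (f ts)
everyTurns-true n f ts eq = everyTurns-sound n f ts eq ∘ Equivalence.from T-≡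

bothClosures-sound : ∀ f ts → T (bothClosures f ts) → T (f (route ts)) × T (f (route ts ++ mirror ∷ []))
bothClosures-sound f ts = to (T-∧ {f (route ts)} {f (route ts ++ mirror ∷ [])})

-- The equations are the defining relations of PGL₂(ℤ), in the form used by `push`; `turn²` and
-- `turn⁻¹` together say that turns have order 3.
record Action : Set₁ where
  field
    Flag    : Set
    act     : Letter → Flag → Flag
    cross²  : ∀ p → act cross (act cross p) ≡ p
    mirror² : ∀ p → act mirror (act mirror p) ≡ p
    turn²   : ∀ t p → act (turn t) (act (turn t) p) ≡ act (turn (opposite t)) p
    turn⁻¹  : ∀ t p → act (turn (opposite t)) (act (turn t) p) ≡ p
    cross-mirror : ∀ p → act cross (act mirror p) ≡ act mirror (act cross p)
    turn-mirror  : ∀ t p → act (turn (opposite t)) (act mirror p) ≡ act mirror (act (turn t) p)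

module Runs (𝔸 : Action) where
  open Action 𝔸
  run : Word → Flag → Flag
  run []      p = p
  run (x ∷ w) p = run w (act x p)

  mirrored : ∀ x p → act (reflect x) (act mirror p) ≡ act mirror (act x p)
  mirrored cross    = cross-mirror
  mirrored (turn t) = turn-mirror t
  mirrored mirror p = refl

  reflect-inverse : ∀ x p → act (reflect x) (act x p) ≡ p
  reflect-inverse cross    = cross²
  reflect-inverse (turn t) = turn⁻¹ t
  reflect-inverse mirror   = mirror²

  run-push : ∀ x w p → run (push x w) p ≡ run w (act x p)
  run-push mirror (mirror ∷ w) p = cong (run w) (sym (mirror² p))
  run-push mirror [] p = refl
  run-push mirror (cross ∷ w) p = refl
  run-push mirror (turn _ ∷ w) p = refl
  run-push cross (mirror ∷ w) p = trans (run-push cross w _) (cong (run w) (cross-mirror p))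
  run-push cross (cross ∷ w) p = cong (run w) (sym (cross² p))
  run-push cross [] p = refl
  run-push cross (turn _ ∷ w) p = refl
  run-push (turn t) (mirror ∷ w) p = trans (run-push _ w _) (cong (run w) (turn-mirror t p))
  run-push (turn left) (turn left ∷ w) p = cong (run w) (sym (turn² left p))
  run-push (turn left) (turn right ∷ w) p = cong (run w) (sym (turn⁻¹ left p))
  run-push (turn right) (turn left ∷ w) p = cong (run w) (sym (turn⁻¹ right p))
  run-push (turn right) (turn right ∷ w) p = cong (run w) (sym (turn² right p))
  run-push (turn left) [] p = refl
  run-push (turn right) [] p = refl
  run-push (turn left) (cross ∷ w) p = refl
  run-push (turn right) (cross ∷ w) p = refl

  run-· : ∀ u w p → run (u · w) p ≡ run w (run u p)
  run-· []      w p = refl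
  run-· (x ∷ u) w p = trans (run-push x (u · w) p) (run-· u w (act x p))

  run-inverseOnto : ∀ w acc p → run (inverseOnto acc w) (run w p) ≡ run acc p
  run-inverseOnto []      acc p = refl
  run-inverseOnto (x ∷ w) acc p = trans (run-inverseOnto w _ (act x p))
    (trans (run-push (reflect x) acc (act x p)) (cong (run acc) (reflect-inverse x p)))

  run-inverse : ∀ w p → run (inverse w) (run w p) ≡ p
  run-inverse w p = run-inverseOnto w [] p

  Fixes : Flag → Word → Set
  Fixes p w = run w p ≡ p

  -- Conjugation moves fixed flags, so cyclic reduction preserves only the existence of one.
  record HasFixedFlag (w : Word) : Set where
    constructor _,_
    field
      point : Flag
      fixed : Fixes point w

  -- If `x ∷ w` fixes `p`, then `w` followed by `x` fixes `act x p`. A leading `mirror` is first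
  -- moved behind the next letter, which thereby becomes its inverse.
  shift-fixed : ∀ w → HasFixedFlag w → HasFixedFlag (shift w)
  shift-fixed [] e = e
  shift-fixed (mirror ∷ []) e = e
  shift-fixed (mirror ∷ x ∷ w) (p , fix) = act (reflect x) p , (begin
    run ((mirror ∷ w) · (reflect x ∷ [])) (act (reflect x) p)
      ≡⟨ run-· (mirror ∷ w) _ _ ⟩
    act (reflect x) (run w (act mirror (act (reflect x) p)))
      ≡⟨ cong (act (reflect x) ∘ run w) (trans (sym (mirrored (reflect x) p)) (cong (λ y → act y (act mirror p)) (reflect-involutive x))) ⟩
    act (reflect x) (run w (act x (act mirror p)))
      ≡⟨ cong (act (reflect x)) fix ⟩
    act (reflect x) p ∎)
    where
    open ≡-Reasoning
    reflect-involutive : ∀ x → reflect (reflect x) ≡ x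
    reflect-involutive cross = refl
    reflect-involutive (turn left) = refl
    reflect-involutive (turn right) = refl
    reflect-involutive mirror = refl
  shift-fixed (cross ∷ w) (p , fix) = act cross p , trans (run-· w _ _) (cong (act cross) fix)
  shift-fixed (turn t ∷ w) (p , fix) = act (turn t) p , trans (run-· w _ _) (cong (act (turn t)) fix)

  fixes-· : ∀ {p} u w → Fixes p u → Fixes p w → Fixes p (u · w)
  fixes-· u w fu fw = trans (run-· u w _) (trans (cong (run w) fu) fw)

  fixes-inverse : ∀ {p} w → Fixes p w → Fixes p (inverse w)
  fixes-inverse {p} w f = trans (cong (run (inverse w)) (sym f)) (run-inverse w p)

  run-opposite : ∀ ts p → run (route (map opposite ts)) (act mirror p) ≡ act mirror (run (route ts) p)
  run-opposite []       p = refl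
  run-opposite (t ∷ ts) p = trans
    (cong (run (route (map opposite ts))) (trans (cong (act (turn (opposite t))) (cross-mirror p)) (turn-mirror t (act cross p))))
    (run-opposite ts (act (turn t) (act cross p)))

  -- This is the source of new words in the case analysis: a path whose three turns are not all
  -- equal is good, and walking round its heptagon fixes the flag, possibly after `mirror`.
  Closable : Set
  Closable = ∀ p t₁ t₂ t₃ → T (not (straight (t₁ ∷ t₂ ∷ t₃ ∷ []))) →
             ∃ λ t₄ → ∃ λ t₅ → ∃ λ t₆ → ∃ λ t₇ → let w = route (t₁ ∷ t₂ ∷ t₃ ∷ t₄ ∷ t₅ ∷ t₆ ∷ t₇ ∷ []) in
             Fixes p w ⊎ Fixes p (w ++ mirror ∷ [])

  -- The second half of each pair treats the same word preceded by `mirror`, which is where normal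
  -- forms carry it.
  record Rigid (forbidden : List Turn → Bool) : Set where
    field
      mirror-free : ∀ p → act mirror p ≢ p
      turn-free   : ∀ t p → act (turn t) p ≢ p × act (turn t) (act mirror p) ≢ p
      cross-free  : ∀ p → act cross p ≢ p × act cross (act mirror p) ≢ p
      legal       : ∀ ts → T (Check.illegalTurns forbidden ts) → ∀ p → run (route ts) p ≢ p × run (route ts) (act mirror p) ≢ p

  module Refutation {forbidden} (rigid : Rigid forbidden) where
    open Check forbidden
    open Rigid rigid

    turns-sound : ∀ w {ts} → turns w ≡ just ts → route ts ≡ w
    turns-sound [] refl = refl
    turns-sound (cross ∷ turn t ∷ w) eq with turns w in eq′
    turns-sound (cross ∷ turn t ∷ w) refl | just ts = cong (λ u → cross ∷ turn t ∷ u) (turns-sound w eq′)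

    turns-legal : ∀ w → T (maybe illegalTurns false (turns w)) → ∀ p → run w p ≢ p × run w (act mirror p) ≢ p
    turns-legal w i p with turns w in eq
    ... | just ts rewrite sym (turns-sound w eq) = legal ts i p

    unmirrored-sound : ∀ w → T (unmirrored w) → ∀ p → run w p ≢ p × run w (act mirror p) ≢ p
    unmirrored-sound (turn t ∷ [])            i p = turn-free t p
    unmirrored-sound (cross ∷ [])             i p = cross-free p
    unmirrored-sound w@(cross ∷ turn _ ∷ _)   i p = turns-legal w i p

    illegal-sound : ∀ w → HasFixedFlag w → T (illegal w) → ⊥
    illegal-sound (mirror ∷ []) (p , f) i = mirror-free p f
    illegal-sound (mirror ∷ w@(_ ∷ _)) (p , f) i = proj₂ (unmirrored-sound w i p) f
    illegal-sound w@(cross ∷ _) (p , f) i = proj₁ (unmirrored-sound w i p) f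
    illegal-sound w@(turn _ ∷ _) (p , f) i = proj₁ (unmirrored-sound w i p) f

    settle-fixed : ∀ n w → HasFixedFlag w → HasFixedFlag (settle n w)
    settle-fixed zero    w e = e
    settle-fixed (suc n) w e with length (shift (shift (shift (shift w)))) <ᵇ length w
    ... | true  = settle-fixed n _ (shift-fixed _ (shift-fixed _ (shift-fixed _ (shift-fixed _ e))))
    ... | false = e

    iterate-fixed : ∀ n {w} → HasFixedFlag w → ListAll.All HasFixedFlag (iterate shift w n)
    iterate-fixed zero    e = []
    iterate-fixed (suc n) e = e ∷ iterate-fixed n (shift-fixed _ e)

    conjugateIllegal-sound : ∀ m n w → HasFixedFlag w → T (conjugateIllegal m n w) → ⊥
    conjugateIllegal-sound m n w e i = any-sound {P = HasFixedFlag} illegal illegal-sound (iterate shift (settle m w) n)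
      (iterate-fixed n (settle-fixed m w e)) (proj₂ (to (T-∧ {length (settle m w) <ᵇ 17}) i))

    module _ {p : Flag} where
      generators-fix : ∀ gs → ListAll.All (Fixes p) gs → ListAll.All (Fixes p) (generators gs)
      generators-fix []       []       = []
      generators-fix (g ∷ gs) (f ∷ fs) = f ∷ fixes-inverse g f ∷ generators-fix gs fs

      products-fix : ∀ gs hs → ListAll.All (Fixes p) gs → ListAll.All (Fixes p) hs → ListAll.All (Fixes p) (cartesianProductWith _·_ gs hs)
      products-fix []       hs []       _  = []
      products-fix (g ∷ gs) hs (f ∷ fs) fh = ListAll.++⁺ (ListAll.map⁺ (ListAll.map (λ {h} → fixes-· g h f) fh)) (products-fix gs hs fs fh)

      contradictory-sound : ∀ g gs → Fixes p g → ListAll.All (Fixes p) gs → T (contradictory g gs) → ⊥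
      contradictory-sound g gs f fs = any-sound {P = Fixes p} (conjugateIllegal 40 16)
        (λ w fix → conjugateIllegal-sound 40 16 w (p , fix)) (productsBy (generators (g ∷ gs)) g)
        (f ∷ ListAll.++⁺ two (products-fix (cartesianProductWith _·_ (g ∷ []) (generators (g ∷ gs))) (generators (g ∷ gs)) two gens))
        where
        gens = generators-fix (g ∷ gs) (f ∷ fs)
        two = products-fix (g ∷ []) (generators (g ∷ gs)) (f ∷ []) gens

      conjugate-fix : ∀ u w → Fixes (run u p) w → Fixes p (conjugate u w)
      conjugate-fix u w fix = trans (run-· u _ p) (trans (run-· w _ _) (trans (cong (run (inverse u)) fix) (run-inverse u p)))

      -- The heptagon supplied by `closable` gives one of the words ranged over by `refutes`;
      -- conjugated by `u`, it fixes the common flag `p` and joins the known words.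
      refutes-sound : Closable → ∀ plan gs → ListAll.All (Fixes p) gs → T (refutes plan gs) → ⊥
      extends-sound : Closable → ∀ plan g gs → Fixes p g → ListAll.All (Fixes p) gs → T (extends plan gs g) → ⊥

      refutes-sound closable ((u , t₁ , t₂ , t₃) ∷ plan) gs fixed r =
        let bent , every = to (T-∧ {not (straight (t₁ ∷ t₂ ∷ t₃ ∷ []))} {everyTurns 4 continues}) r
            t₄ , t₅ , t₆ , t₇ , closed = closable (run u p) t₁ t₂ t₃ bent
            ts = t₄ ∷ t₅ ∷ t₆ ∷ t₇ ∷ []
            r₁ , r₂ = bothClosures-sound (λ w → extends plan gs (conjugate u w)) (t₁ ∷ t₂ ∷ t₃ ∷ ts)
                        (everyTurns-sound 4 continues ts refl every)
        in [ extended (route (t₁ ∷ t₂ ∷ t₃ ∷ ts)) r₁ , extended (route (t₁ ∷ t₂ ∷ t₃ ∷ ts) ++ mirror ∷ []) r₂ ] closed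
        where
        continues : List Turn → Bool
        continues ts = bothClosures (λ w → extends plan gs (conjugate u w)) (t₁ ∷ t₂ ∷ t₃ ∷ ts)
        extended : ∀ w → T (extends plan gs (conjugate u w)) → ¬ Fixes (run u p) w
        extended w r fix = extends-sound closable plan (conjugate u w) gs (conjugate-fix u w fix) fixed r

      extends-sound closable plan g gs fix fixed r =
        [ contradictory-sound g gs fix fixed , refutes-sound closable plan (g ∷ gs) (fix ∷ fixed) ]
          (to (T-∨ {contradictory g gs} {refutes plan (g ∷ gs)}) r)

-- Cycles as vectors

∷ʳ⁺ : ∀ {A : Set} {P : A → Set} {n} {xs : Vec A n} {x} → All P xs → P x → All P (xs ∷ʳ x)
∷ʳ⁺ []         q = q ∷ []
∷ʳ⁺ (p ∷ ps)   q = p ∷ ∷ʳ⁺ ps q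

module _ {A : Set} where

  ∈-∷ʳˡ : ∀ {n} {xs : Vec A n} {x z} → z ∈ xs → z ∈ xs ∷ʳ x
  ∈-∷ʳˡ (here eq)  = here eq
  ∈-∷ʳˡ (there z∈) = there (∈-∷ʳˡ z∈)

  ∈-∷ʳʳ : ∀ {n} (xs : Vec A n) {x z} → z ≡ x → z ∈ xs ∷ʳ x
  ∈-∷ʳʳ []       eq = here eq
  ∈-∷ʳʳ (_ ∷ xs) eq = there (∈-∷ʳʳ xs eq)

  ∈-∷ʳ⁻ : ∀ {n} (xs : Vec A n) {x z} → z ∈ xs ∷ʳ x → z ∈ x ∷ xs
  ∈-∷ʳ⁻ []       z∈         = z∈
  ∈-∷ʳ⁻ (_ ∷ xs) (here eq)  = there (here eq)
  ∈-∷ʳ⁻ (_ ∷ xs) (there z∈) with ∈-∷ʳ⁻ xs z∈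
  ... | here eq = here eq
  ... | there z∈′ = there (there z∈′)

  ∈-rotate : ∀ {n} (xs : Vec A n) {z} → z ∈ xs ⇔ z ∈ rotate xs
  ∈-rotate []       = mk⇔ id id
  ∈-rotate (x ∷ xs) = mk⇔ (λ { (here eq) → ∈-∷ʳʳ xs eq ; (there z∈) → ∈-∷ʳˡ z∈ }) (∈-∷ʳ⁻ xs)

  rotate-all : ∀ {P : A → Set} {n} {xs : Vec A n} → All P xs → All P (rotate xs)
  rotate-all []       = []
  rotate-all (p ∷ ps) = ∷ʳ⁺ ps p

  ∷ʳ-unique : ∀ {n} {xs : Vec A n} {x} → All (x ≢_) xs → Unique xs → Unique (xs ∷ʳ x)
  ∷ʳ-unique []       []       = [] ∷ []
  ∷ʳ-unique (p ∷ ps) (q ∷ qs) = ∷ʳ⁺ q (≢-sym p) ∷ ∷ʳ-unique ps qs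

  rotate-unique : ∀ {n} {xs : Vec A n} → Unique xs → Unique (rotate xs)
  rotate-unique []       = []
  rotate-unique (p ∷ ps) = ∷ʳ-unique p ps

  rotate-steps : (xs : Vec A 7) → steps (rotate xs) ≡ rotate (steps xs)
  rotate-steps (_ ∷ _ ∷ _ ∷ _ ∷ _ ∷ _ ∷ _ ∷ []) = refl

rotate-sameEdges : ∀ {v} (xs : Vec (Fin v) 7) → SameEdges xs (rotate xs)
rotate-sameEdges xs x y rewrite rotate-steps xs = mk⇔
  (Sum.map (to (∈-rotate _)) (to (∈-rotate _)))
  (Sum.map (Equivalence.from (∈-rotate _)) (Equivalence.from (∈-rotate _)))

rotate-isCycle : ∀ {v} {G : Graph v} {xs : Vec (Fin v) 7} → IsCycle G xs → IsCycle G (rotate xs)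
rotate-isCycle {G = G} {xs} c = record
  { 3≤length = 3≤length
  ; distinct = rotate-unique distinct
  ; adjacent = subst (All (uncurry (Graph.Adj G))) (sym (rotate-steps xs)) (rotate-all adjacent)
  }
  where open IsCycle c

sameEdges-trans : ∀ {v n} {xs ys zs : Vec (Fin v) n} → SameEdges xs ys → SameEdges ys zs → SameEdges xs zs
sameEdges-trans p q x y = ⇔.trans (p x y) (q x y)

_⟳_ : ∀ {A : Set} {n} → ℕ → Vec A n → Vec A n
zero  ⟳ xs = xs
suc k ⟳ xs = k ⟳ rotate xs

⟳-isCycle : ∀ {v} {G : Graph v} k {xs : Vec (Fin v) 7} → IsCycle G xs → IsCycle G (k ⟳ xs)
⟳-isCycle zero    c = c
⟳-isCycle (suc k) c = ⟳-isCycle k (rotate-isCycle c)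

⟳-sameEdges : ∀ {v} k (xs : Vec (Fin v) 7) → SameEdges xs (k ⟳ xs)
⟳-sameEdges zero    xs x y = ⇔.refl
⟳-sameEdges (suc k) xs = sameEdges-trans {ys = rotate xs} (rotate-sameEdges xs) (⟳-sameEdges k (rotate xs))

-- Since the vertices are distinct, only the first and the last step involve `c₀`. Thus the edge set
-- determines the two neighbours of a vertex on the cycle.
hasEdge-head : ∀ {v} {c₀ c₁ c₂ c₃ c₄ c₅ c₆ z : Fin v} (let xs = c₀ ∷ c₁ ∷ c₂ ∷ c₃ ∷ c₄ ∷ c₅ ∷ c₆ ∷ []) →
               Unique xs → HasEdge xs c₀ z → z ≡ c₁ ⊎ z ≡ c₆
hasEdge-head u (inj₁ (here refl)) = inj₁ refl
hasEdge-head ((_ ∷ _ ∷ _ ∷ _ ∷ _ ∷ _ ∷ []) ∷ _) (inj₂ (there (there (there (there (there (there (here refl)))))))) = inj₂ refl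
hasEdge-head ((n ∷ _) ∷ _) (inj₁ (there (here refl))) = contradiction refl n
hasEdge-head ((_ ∷ n ∷ _) ∷ _) (inj₁ (there (there (here refl)))) = contradiction refl n
hasEdge-head ((_ ∷ _ ∷ n ∷ _) ∷ _) (inj₁ (there (there (there (here refl))))) = contradiction refl n
hasEdge-head ((_ ∷ _ ∷ _ ∷ n ∷ _) ∷ _) (inj₁ (there (there (there (there (here refl)))))) = contradiction refl n
hasEdge-head ((_ ∷ _ ∷ _ ∷ _ ∷ n ∷ _) ∷ _) (inj₁ (there (there (there (there (there (here refl))))))) = contradiction refl n
hasEdge-head ((_ ∷ _ ∷ _ ∷ _ ∷ _ ∷ n ∷ []) ∷ _) (inj₁ (there (there (there (there (there (there (here refl)))))))) = contradiction refl n
hasEdge-head ((n ∷ _) ∷ _) (inj₂ (here refl)) = contradiction refl n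
hasEdge-head ((_ ∷ n ∷ _) ∷ _) (inj₂ (there (here refl))) = contradiction refl n
hasEdge-head ((_ ∷ _ ∷ n ∷ _) ∷ _) (inj₂ (there (there (here refl)))) = contradiction refl n
hasEdge-head ((_ ∷ _ ∷ _ ∷ n ∷ _) ∷ _) (inj₂ (there (there (there (here refl))))) = contradiction refl n
hasEdge-head ((_ ∷ _ ∷ _ ∷ _ ∷ n ∷ _) ∷ _) (inj₂ (there (there (there (there (here refl)))))) = contradiction refl n
hasEdge-head ((_ ∷ _ ∷ _ ∷ _ ∷ _ ∷ n ∷ []) ∷ _) (inj₂ (there (there (there (there (there (here refl))))))) = contradiction refl n

-- The given edge is rotated into second place, where it is the edge `u v` of a path `x u v w y`.
align : ∀ {v} {G : Graph v} {a b} (xs : Vec (Fin v) 7) → IsCycle G xs → (a , b) ∈ steps xs →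
        ∃ λ x → ∃ λ w → ∃ λ y → ∃ λ p → ∃ λ q → let ys = x ∷ a ∷ b ∷ w ∷ y ∷ p ∷ q ∷ [] in IsCycle G ys × SameEdges xs ys
align xs@(_ ∷ _ ∷ _ ∷ _ ∷ _ ∷ _ ∷ _ ∷ []) c (here refl)
  = _ , _ , _ , _ , _ , ⟳-isCycle 6 c , ⟳-sameEdges 6 xs
align xs@(_ ∷ _ ∷ _ ∷ _ ∷ _ ∷ _ ∷ _ ∷ []) c (there (here refl))
  = _ , _ , _ , _ , _ , ⟳-isCycle 0 c , ⟳-sameEdges 0 xs
align xs@(_ ∷ _ ∷ _ ∷ _ ∷ _ ∷ _ ∷ _ ∷ []) c (there (there (here refl)))
  = _ , _ , _ , _ , _ , ⟳-isCycle 1 c , ⟳-sameEdges 1 xs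
align xs@(_ ∷ _ ∷ _ ∷ _ ∷ _ ∷ _ ∷ _ ∷ []) c (there (there (there (here refl))))
  = _ , _ , _ , _ , _ , ⟳-isCycle 2 c , ⟳-sameEdges 2 xs
align xs@(_ ∷ _ ∷ _ ∷ _ ∷ _ ∷ _ ∷ _ ∷ []) c (there (there (there (there (here refl)))))
  = _ , _ , _ , _ , _ , ⟳-isCycle 3 c , ⟳-sameEdges 3 xs
align xs@(_ ∷ _ ∷ _ ∷ _ ∷ _ ∷ _ ∷ _ ∷ []) c (there (there (there (there (there (here refl))))))
  = _ , _ , _ , _ , _ , ⟳-isCycle 4 c , ⟳-sameEdges 4 xs
align xs@(_ ∷ _ ∷ _ ∷ _ ∷ _ ∷ _ ∷ _ ∷ []) c (there (there (there (there (there (there (here refl)))))))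
  = _ , _ , _ , _ , _ , ⟳-isCycle 5 c , ⟳-sameEdges 5 xs

-- The reversed cycle starts at `c₃` so that the edge between `c₁` and `c₂` stays in second place.
∈-steps-reverse : ∀ {v} {c₀ c₁ c₂ c₃ c₄ c₅ c₆ a b : Fin v} → (a , b) ∈ steps (c₀ ∷ c₁ ∷ c₂ ∷ c₃ ∷ c₄ ∷ c₅ ∷ c₆ ∷ []) →
                  (b , a) ∈ steps (c₃ ∷ c₂ ∷ c₁ ∷ c₀ ∷ c₆ ∷ c₅ ∷ c₄ ∷ [])
∈-steps-reverse (here refl)                                                 = there (there (here refl))
∈-steps-reverse (there (here refl))                                         = there (here refl)
∈-steps-reverse (there (there (here refl)))                                 = here refl
∈-steps-reverse (there (there (there (here refl))))                         = there (there (there (there (there (there (here refl))))))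
∈-steps-reverse (there (there (there (there (here refl)))))                 = there (there (there (there (there (here refl)))))
∈-steps-reverse (there (there (there (there (there (here refl))))))         = there (there (there (there (here refl))))
∈-steps-reverse (there (there (there (there (there (there (here refl))))))) = there (there (there (here refl)))

reverse-sameEdges : ∀ {v} {c₀ c₁ c₂ c₃ c₄ c₅ c₆ : Fin v} →
                    SameEdges (c₀ ∷ c₁ ∷ c₂ ∷ c₃ ∷ c₄ ∷ c₅ ∷ c₆ ∷ []) (c₃ ∷ c₂ ∷ c₁ ∷ c₀ ∷ c₆ ∷ c₅ ∷ c₄ ∷ [])
reverse-sameEdges x y = mk⇔ (Sum.swap ∘ Sum.map ∈-steps-reverse ∈-steps-reverse)
                            (Sum.swap ∘ Sum.map ∈-steps-reverse ∈-steps-reverse)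

-- Counting

bit : Bool → ℕ
bit true  = 1
bit false = 0

total : (Bool → ℕ) → ℕ
total f = f false + f true

T↔Fin : ∀ b → T b ↔ Fin (bit b)
T↔Fin true  = mk↔ₛ′ (λ _ → zero) (λ _ → tt) (λ { zero → refl }) (λ _ → refl)
T↔Fin false = mk↔ₛ′ (λ ()) (λ ()) (λ ()) (λ ())

Σ↔Fin : ∀ {P : Bool → Set} {f} → (∀ b → P b ↔ Fin (f b)) → Σ Bool P ↔ Fin (total f)
Σ↔Fin {P} φ = ↔-trans Σ↔⊎ (↔-trans (φ false ⊎-↔ φ true) (↔-sym +↔⊎))
  where
  Σ↔⊎ : Σ Bool P ↔ (P false ⊎ P true)
  Σ↔⊎ = mk↔ₛ′ (λ { (false , x) → inj₁ x ; (true , x) → inj₂ x }) [ false ,_ , true ,_ ]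
                (λ { (inj₁ _) → refl ; (inj₂ _) → refl }) (λ { (false , _) → refl ; (true , _) → refl })

-- Add the first two equations and subtract the third. It is applied to the three pairs of edges at
-- a vertex, where each edge lies in two pairs.
thirds : ∀ {k} a b c → a + b ≡ k + k → a + c ≡ k + k → b + c ≡ k + k → a ≡ k
thirds {k} a b c ab ac bc = *-cancelˡ-≡ a k 2 (+-cancelʳ-≡ (b + c) (2 * a) (2 * k) (begin
  2 * a + (b + c)       ≡⟨ regroup a b c ⟩
  (a + b) + (a + c)     ≡⟨ cong₂ _+_ ab ac ⟩
  (k + k) + (k + k)     ≡⟨ double k ⟩
  2 * k + (k + k)       ≡⟨ cong (2 * k +_) bc ⟨
  2 * k + (b + c)       ∎))
  where
  open ≡-Reasoning
  regroup : ∀ a b c → 2 * a + (b + c) ≡ (a + b) + (a + c)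
  regroup = solve-∀
  double : ∀ k → (k + k) + (k + k) ≡ 2 * k + (k + k)
  double = solve-∀

unique-false : ∀ (f : Bool → Bool → Bool) → total (λ s → total λ t → bit (f s t)) ≡ 3 →
               ∃ λ s → ∃ λ t → f s t ≡ false × (∀ {s′ t′} → f s′ t′ ≡ false → s′ ≡ s × t′ ≡ t)
unique-false f three with f false false in ff | f false true in ft | f true false in tf | f true true in tt′
unique-false f () | true | true | true | true
unique-false f () | false | false | false | false
unique-false f () | false | false | false | true
unique-false f () | false | false | true  | false
unique-false f () | false | false | true  | true
unique-false f () | false | true | false | false
unique-false f () | false | true | false | true
unique-false f () | false | true | true | false
unique-false f () | true | false | false | false
unique-false f () | true | false | false | true
unique-false f () | true | false | true | false
unique-false f () | true | true | false | false
unique-false f refl | false | true | true | true = false , false , ff , λ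
  { {false} {false} _ → refl , refl
  ; {false} {true}  e → contradiction (trans (sym e) ft) λ ()
  ; {true}  {false} e → contradiction (trans (sym e) tf) λ ()
  ; {true}  {true}  e → contradiction (trans (sym e) tt′) λ () }
unique-false f refl | true | false | true | true = false , true , ft , λ
  { {false} {false} e → contradiction (trans (sym e) ff) λ ()
  ; {false} {true}  _ → refl , refl
  ; {true}  {false} e → contradiction (trans (sym e) tf) λ ()
  ; {true}  {true}  e → contradiction (trans (sym e) tt′) λ () }
unique-false f refl | true | true | false | true = true , false , tf , λ
  { {false} {false} e → contradiction (trans (sym e) ff) λ ()
  ; {false} {true}  e → contradiction (trans (sym e) ft) λ ()
  ; {true}  {false} _ → refl , refl
  ; {true}  {true}  e → contradiction (trans (sym e) tt′) λ () }
unique-false f refl | true | true | true | false = true , true , tt′ , λ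
  { {false} {false} e → contradiction (trans (sym e) ff) λ ()
  ; {false} {true}  e → contradiction (trans (sym e) ft) λ ()
  ; {true}  {false} e → contradiction (trans (sym e) tf) λ ()
  ; {true}  {true}  _ → refl , refl }

both : ∀ {P : Bool → Set} → P false → P true → ∀ b → P b
both f t false = f
both f t true  = t

same-sound : ∀ {t t′} → T (same t t′) → t ≡ t′
same-sound {left}  {left}  _ = refl
same-sound {right} {right} _ = refl

pick : ∀ {A : Set} → Turn → A → A → A
pick left  a b = a
pick right a b = b

-- Non-backtracking walks

module Walks {v} (G : Graph v) where
  open Graph G renaming (sym to Adj-sym)

  V : Set
  V = Fin v

  -- The head of the vector is two steps after `x` on the walk, so this forbids immediate
  -- backtracking only.
  Avoids : ∀ {n} → V → Vec V n → Set
  Avoids x []      = ⊤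
  Avoids x (z ∷ _) = x ≢ z

  Departs : ∀ {n} → V → Vec V n → Set
  Departs x []       = ⊤
  Departs x (y ∷ ys) = Adj x y × Avoids x ys

  Walk : ∀ {n} → Vec V n → Set
  Walk []       = ⊤
  Walk (x ∷ xs) = Departs x xs × Walk xs

  avoids? : ∀ {n} x (xs : Vec V n) → Dec (Avoids x xs)
  avoids? x []      = yes tt
  avoids? x (z ∷ _) = ¬? (x ≟ z)

  departs? : ∀ {n} x (xs : Vec V n) → Dec (Departs x xs)
  departs? x []       = yes tt
  departs? x (y ∷ ys) = adj? x y ×-dec avoids? x ys

  walk? : ∀ {n} (xs : Vec V n) → Dec (Walk xs)
  walk? []       = yes tt
  walk? (x ∷ xs) = departs? x xs ×-dec walk? xs

  walk-init : ∀ {n} (xs : Vec V n) {z} → Walk (xs ∷ʳ z) → Walk xs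
  walk-init []               _             = tt
  walk-init (x ∷ [])         _             = tt , tt
  walk-init (x ∷ y ∷ [])     ((a , _) , w) = (a , tt) , walk-init (y ∷ []) w
  walk-init (x ∷ y ∷ z ∷ xs) (d , w)       = d , walk-init (y ∷ z ∷ xs) w

  walk-adjacent : ∀ {n} x (xs : Vec V n) {z} → Walk (x ∷ (xs ∷ʳ z)) → All (uncurry Adj) (zip (x ∷ xs) (xs ∷ʳ z))
  walk-adjacent x []       ((a , _) , _) = a ∷ []
  walk-adjacent x (y ∷ xs) ((a , _) , w) = a ∷ walk-adjacent y xs w

  module _ (short-free : ∀ {n} → n < 7 → ¬ HasCycle G n) where

    -- By induction, a first return to `x` would close up distinct vertices: a loop, a backtracking
    -- step, or a cycle of length at most 6.
    walk-unique : ∀ {n} (xs : Vec V n) → n ≤ 7 → Walk xs → Unique xs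
    walk-open   : ∀ {n} x (xs : Vec V n) → n ≤ 6 → Walk (x ∷ xs) → All (x ≢_) xs
    unclosed : ∀ {n} x (zs : Vec V n) → n ≤ 5 → Unique (x ∷ zs) → ¬ Walk (x ∷ (zs ∷ʳ x))

    walk-unique         []       _         _       = []
    walk-unique {suc n} (x ∷ xs) (s≤s n≤6) (d , w) =
      walk-open x xs n≤6 (d , w) ∷ walk-unique xs (≤-trans n≤6 (n≤1+n 6)) w

    walk-open {zero}  x [] _         _ = []
    walk-open {suc n} x xs (s≤s n≤5) w with initLast xs
    ... | zs , z , refl = ∷ʳ⁺ away (λ { refl → unclosed x zs n≤5 (away ∷ walk-unique zs n≤7 (proj₂ w′)) w })
      where
      w′   = walk-init (x ∷ zs) w
      away = walk-open x zs (≤-trans n≤5 (n≤1+n 5)) w′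
      n≤7  = ≤-trans n≤5 (≤-trans (n≤1+n 5) (n≤1+n 6))

    unclosed x []               _   _ ((a , _) , _)     = irrefl refl a
    unclosed x (y ∷ [])         _   _ ((_ , x≢x) , _)   = x≢x refl
    unclosed x zs@(_ ∷ _ ∷ _) n≤5 u w = short-free (s≤s (s≤s n≤5))
      (x ∷ zs , record { 3≤length = s≤s (s≤s (s≤s z≤n)) ; distinct = u ; adjacent = walk-adjacent x zs w })

-- Heptagons in the cubic graph

module Cubic {v} (G : Graph v) (egr : IsEdgeGirthRegular G 3 7 6) where
  open Graph G renaming (sym to Adj-sym)
  open IsEdgeGirthRegular egr
  open Walks G

  unique : ∀ {n} (xs : Vec V n) {n≤7 : True (n ≤? 7)} → Walk xs → Unique xs
  unique xs {n≤7} = walk-unique (proj₂ girth) xs (toWitness n≤7)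

  no-return : ∀ {n} x (xs : Vec V n) {n≤6 : True (n ≤? 6)} → Walk (x ∷ xs) → ¬ x ∈ xs
  no-return x xs {n≤6} w x∈ = All.lookup (walk-open (proj₂ girth) x xs (toWitness n≤6) w) x∈ refl

  -- The two ways on from `u` for a walk coming from `v`, in an arbitrary order.
  record Fork (u v : V) : Set where
    field
      branch   : Bool → V
      adjacent : ∀ s → Adj u (branch s)
      forward  : ∀ s → branch s ≢ v
      split    : branch false ≢ branch true
      complete : ∀ {y} → Adj u y → y ≢ v → ∃ λ s → y ≡ branch s

    injective : ∀ {s t} → branch s ≡ branch t → s ≡ t
    injective {false} {false} eq = refl
    injective {true}  {true}  eq = refl
    injective {false} {true}  eq = contradiction eq split
    injective {true}  {false} eq = contradiction (sym eq) split

  abstract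
    fork : ∀ {u v} → Adj u v → Fork u v
    fork {u} {v} u~v = fork-among (neighbours u) (regular u) (List.filter⁺ (adj? u) (List.allFin⁺ _))
        (λ y∈ → proj₂ (List.∈-filter⁻ (adj? u) {xs = List.allFin _} y∈)) (λ a → List.∈-filter⁺ (adj? u) (List.∈-allFin _) a)
      where
      fork-of : ∀ {ns} a b → a ≢ b → v ≢ a → v ≢ b → Adj u a → Adj u b →
                (∀ {y} → Adj u y → y List.∈ ns) → (∀ {y} → y List.∈ ns → y ≢ v → y ≡ a ⊎ y ≡ b) → Fork u v
      fork-of a b a≢b v≢a v≢b u~a u~b complete only = record
        { branch   = both a b
        ; adjacent = both u~a u~b
        ; forward  = both (≢-sym v≢a) (≢-sym v≢b)
        ; split    = a≢b
        ; complete = λ u~y y≢v → [ false ,_ , true ,_ ] (only (complete u~y) y≢v)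
        }
      fork-among : ∀ ns → List.length ns ≡ 3 → List.Unique ns →
                   (∀ {y} → y List.∈ ns → Adj u y) → (∀ {y} → Adj u y → y List.∈ ns) → Fork u v
      fork-among (a ∷ b ∷ c ∷ []) refl ((a≢b ∷ a≢c ∷ []) ∷ (b≢c ∷ []) ∷ _) sound complete with complete u~v
      ... | List.here refl = fork-of b c b≢c a≢b a≢c
              (sound (List.there (List.here refl))) (sound (List.there (List.there (List.here refl)))) complete
              λ { (List.here refl)                         n → contradiction refl n
                ; (List.there (List.here eq))              _ → inj₁ eq
                ; (List.there (List.there (List.here eq))) _ → inj₂ eq }
      ... | List.there (List.here refl) = fork-of a c a≢c (≢-sym a≢b) b≢c
              (sound (List.here refl)) (sound (List.there (List.there (List.here refl)))) complete
              λ { (List.here eq)                           _ → inj₁ eq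
                ; (List.there (List.here eq))              n → contradiction eq n
                ; (List.there (List.there (List.here eq))) _ → inj₂ eq }
      ... | List.there (List.there (List.here refl)) = fork-of a b a≢b (≢-sym a≢c) (≢-sym b≢c)
              (sound (List.here refl)) (sound (List.there (List.here refl))) complete
              λ { (List.here eq)                           _ → inj₁ eq
                ; (List.there (List.here eq))              _ → inj₂ eq
                ; (List.there (List.there (List.here eq))) n → contradiction eq n }

  -- The repetition of c₀ , c₁ prevents backtracking at c₆ and c₀ as well.
  Heptagon : (c₀ c₁ c₂ c₃ c₄ c₅ c₆ : V) → Set
  Heptagon c₀ c₁ c₂ c₃ c₄ c₅ c₆ = Walk (c₀ ∷ c₁ ∷ c₂ ∷ c₃ ∷ c₄ ∷ c₅ ∷ c₆ ∷ c₀ ∷ c₁ ∷ [])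

  Good : (x u v w y : V) → Set
  Good x u v w y = ∃₂ λ p q → Heptagon x u v w y p q

  abstract
    good? : ∀ x u v w y → Dec (Good x u v w y)
    good? x u v w y = any? λ p → any? λ q → walk? _

  module _ {c₀ c₁ c₂ c₃ c₄ c₅ c₆ : V} where

    heptagon⇒cycle : Heptagon c₀ c₁ c₂ c₃ c₄ c₅ c₆ → IsCycle G (c₀ ∷ c₁ ∷ c₂ ∷ c₃ ∷ c₄ ∷ c₅ ∷ c₆ ∷ [])
    heptagon⇒cycle h@((a₀₁ , _) , (a₁₂ , _) , (a₂₃ , _) , (a₃₄ , _) , (a₄₅ , _) , (a₅₆ , _) , (a₆₀ , _) , _) = record
      { 3≤length = s≤s (s≤s (s≤s z≤n))
      ; distinct = unique (c₀ ∷ c₁ ∷ c₂ ∷ c₃ ∷ c₄ ∷ c₅ ∷ c₆ ∷ [])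
          (walk-init (c₀ ∷ c₁ ∷ c₂ ∷ c₃ ∷ c₄ ∷ c₅ ∷ c₆ ∷ [])
          (walk-init (c₀ ∷ c₁ ∷ c₂ ∷ c₃ ∷ c₄ ∷ c₅ ∷ c₆ ∷ c₀ ∷ []) h))
      ; adjacent = a₀₁ ∷ a₁₂ ∷ a₂₃ ∷ a₃₄ ∷ a₄₅ ∷ a₅₆ ∷ a₆₀ ∷ []
      }

    cycle⇒heptagon : IsCycle G (c₀ ∷ c₁ ∷ c₂ ∷ c₃ ∷ c₄ ∷ c₅ ∷ c₆ ∷ []) → Heptagon c₀ c₁ c₂ c₃ c₄ c₅ c₆
    cycle⇒heptagon record
      { distinct = (_ ∷ n₀₂ ∷ _ ∷ _ ∷ n₀₅ ∷ _) ∷ (_ ∷ n₁₃ ∷ _ ∷ _ ∷ n₁₆ ∷ _) ∷ (_ ∷ n₂₄ ∷ _) ∷ (_ ∷ n₃₅ ∷ _) ∷ (_ ∷ n₄₆ ∷ _) ∷ _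
      ; adjacent = a₀₁ ∷ a₁₂ ∷ a₂₃ ∷ a₃₄ ∷ a₄₅ ∷ a₅₆ ∷ a₆₀ ∷ []
      } = (a₀₁ , n₀₂) , (a₁₂ , n₁₃) , (a₂₃ , n₂₄) , (a₃₄ , n₃₅) , (a₄₅ , n₄₆) , (a₅₆ , ≢-sym n₀₅) , (a₆₀ , ≢-sym n₁₆) , (a₀₁ , tt) , tt , tt

    heptagon-reverse : Heptagon c₀ c₁ c₂ c₃ c₄ c₅ c₆ → Heptagon c₃ c₂ c₁ c₀ c₆ c₅ c₄
    heptagon-reverse ((a₀₁ , n₀₂) , (a₁₂ , n₁₃) , (a₂₃ , n₂₄) , (a₃₄ , n₃₅) , (a₄₅ , n₄₆) , (a₅₆ , n₅₀) , (a₆₀ , n₆₁) , _) =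
      (Adj-sym a₂₃ , ≢-sym n₁₃) , (Adj-sym a₁₂ , ≢-sym n₀₂) , (Adj-sym a₀₁ , ≢-sym n₆₁) , (Adj-sym a₆₀ , ≢-sym n₅₀) ,
      (Adj-sym a₅₆ , ≢-sym n₄₆) , (Adj-sym a₄₅ , ≢-sym n₃₅) , (Adj-sym a₃₄ , ≢-sym n₂₄) , (Adj-sym a₂₃ , tt) , tt , tt

  -- Two different closings would together form a closed non-backtracking walk of four or six steps.
  closing-unique : ∀ {x u v w y p q p′ q′} → Heptagon x u v w y p q → Heptagon x u v w y p′ q′ → p ≡ p′ × q ≡ q′
  closing-unique {x} {y = y} {p} {q} {p′} {q′}
    (_ , _ , _ , _ , (y~p , y≢q) , (p~q , p≢x) , (q~x , _) , _)
    (_ , _ , _ , _ , (y~p′ , y≢q′) , (p′~q′ , p′≢x) , (q′~x , _) , _) with p ≟ p′ | q ≟ q′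
  ... | yes p≡p′ | yes q≡q′ = p≡p′ , q≡q′
  ... | yes refl | no q≢q′ = contradiction (there (there (there (here refl))))
    (no-return p (q ∷ x ∷ q′ ∷ p ∷ []) ((p~q , p≢x) , (q~x , q≢q′) , (Adj-sym q′~x , ≢-sym p≢x) , (Adj-sym p′~q′ , tt) , tt , tt))
  ... | no p≢p′ | yes refl = contradiction (there (there (there (here refl))))
    (no-return q (p ∷ y ∷ p′ ∷ q ∷ []) ((Adj-sym p~q , ≢-sym y≢q) , (Adj-sym y~p , p≢p′) , (y~p′ , y≢q) , (p′~q′ , tt) , tt , tt))
  ... | no p≢p′ | no q≢q′ = contradiction (there (there (there (there (there (here refl))))))
    (no-return y (p ∷ q ∷ x ∷ q′ ∷ p′ ∷ y ∷ [])
      ((y~p , y≢q) , (p~q , p≢x) , (q~x , q≢q′) , (Adj-sym q′~x , ≢-sym p′≢x) , (Adj-sym p′~q′ , ≢-sym y≢q′) , (Adj-sym y~p′ , tt) , tt , tt))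

  through : ∀ {a b} (c : Σ[ xs ∈ Vec V 7 ] (IsCycle G xs × HasEdge xs a b)) →
            ∃ λ x → ∃ λ w → ∃ λ y → ∃ λ p → ∃ λ q → Heptagon x a b w y p q × SameEdges (proj₁ c) (x ∷ a ∷ b ∷ w ∷ y ∷ p ∷ q ∷ [])
  through (xs , c , inj₁ ab∈) with _ , _ , _ , _ , _ , c′ , eq ← align xs c ab∈ = _ , _ , _ , _ , _ , cycle⇒heptagon c′ , eq
  through (xs , c , inj₂ ba∈) with x , w , y , p , q , c′ , eq ← align xs c ba∈ =
    _ , _ , _ , _ , _ , heptagon-reverse (cycle⇒heptagon c′) ,
    sameEdges-trans {xs = xs} {ys = x ∷ _ ∷ _ ∷ w ∷ y ∷ p ∷ q ∷ []} {zs = w ∷ _ ∷ _ ∷ x ∷ q ∷ p ∷ y ∷ []} eq reverse-sameEdges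

  -- The edge set determines the neighbours on the heptagon: at `u` this recovers `x`, at `v` it
  -- recovers `w`, and then at `w` it recovers `y`.
  heptagon-path : ∀ {x x′ u v w w′ y y′ p p′ q q′} → Heptagon x u v w y p q → Heptagon x′ u v w′ y′ p′ q′ →
                  SameEdges (x ∷ u ∷ v ∷ w ∷ y ∷ p ∷ q ∷ []) (x′ ∷ u ∷ v ∷ w′ ∷ y′ ∷ p′ ∷ q′ ∷ []) →
                  x ≡ x′ × w ≡ w′ × y ≡ y′
  heptagon-path {x} {x′} {u} {v} {w} {w′} {y} {y′} {p} {p′} {q} {q′} h h′ same = x≡ , w≡ , y≡
    where
    ys = x′ ∷ u ∷ v ∷ w′ ∷ y′ ∷ p′ ∷ q′ ∷ []
    distinct : ∀ k → Unique (k ⟳ ys)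
    distinct k = IsCycle.distinct (⟳-isCycle k (heptagon⇒cycle h′))
    edge : ∀ k a b → HasEdge (x ∷ u ∷ v ∷ w ∷ y ∷ p ∷ q ∷ []) a b → HasEdge (k ⟳ ys) a b
    edge k a b e = Equivalence.to (⟳-sameEdges k ys a b) (Equivalence.to (same a b) e)
    x≡ : x ≡ x′
    x≡ with hasEdge-head (distinct 1) (edge 1 u x (inj₂ (here refl)))
    ... | inj₁ x≡v  = contradiction x≡v (proj₂ (proj₁ h))
    ... | inj₂ x≡x′ = x≡x′
    w≡ : w ≡ w′
    w≡ with hasEdge-head (distinct 2) (edge 2 v w (inj₁ (there (there (here refl)))))
    ... | inj₁ w≡w′ = w≡w′
    ... | inj₂ w≡u  = contradiction (sym w≡u) (proj₂ (proj₁ (proj₂ h)))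
    y≡ : y ≡ y′
    y≡ with hasEdge-head (distinct 3) (subst (λ z → HasEdge (3 ⟳ ys) z y) w≡ (edge 3 w y (inj₁ (there (there (there (here refl)))))))
    ... | inj₁ y≡y′ = y≡y′
    ... | inj₂ y≡v  = contradiction (sym y≡v) (proj₂ (proj₁ (proj₂ (proj₂ h))))

  -- Counting good paths

  good : (x u v w y : V) → Bool
  good x u v w y = ⌊ good? x u v w y ⌋

  module _ {u v} (u~v : Adj u v) (X : Fork u v) (W : Fork v u) (Y : ∀ j → Fork (Fork.branch W j) v) where
    open Fork

    -- The good paths around the edge `u v`, coded by choices in the forks; the last component is
    -- proof-irrelevant, so the path determines the code.
    Extension : Set
    Extension = Σ[ j ∈ Bool ] Σ[ s ∈ Bool ] Σ[ t ∈ Bool ] T (good (branch X s) u v (branch W j) (branch (Y j) t))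

    open Setoid (cyclesThrough G 7 u v) using (_≈_) renaming (Carrier to CycleThrough; trans to ≈-trans; sym to ≈-sym)

    closing : (k@(j , s , t , _) : Extension) → Good (branch X s) u v (branch W j) (branch (Y j) t)
    closing (_ , _ , _ , good) = toWitness good

    toCycle : Extension → CycleThrough
    toCycle k = let _ , _ , h = closing k in _ , heptagon⇒cycle h , inj₁ (there (here refl))

    extension-≡ : ∀ {j j′ s s′ t t′ g g′} → branch X s ≡ branch X s′ → branch W j ≡ branch W j′ →
                  branch (Y j) t ≡ branch (Y j′) t′ → _≡_ {A = Extension} (j , s , t , g) (j′ , s′ , t′ , g′)
    extension-≡ {j} x≡ w≡ y≡ with refl ← injective W w≡ | refl ← injective X x≡ with refl ← injective (Y j) y≡ =
      cong (λ g → j , _ , _ , g) (T-irrelevant _ _)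

    toCycle-injective : ∀ k k′ → toCycle k ≈ toCycle k′ → k ≡ k′
    toCycle-injective k k′ same =
      let x≡ , w≡ , y≡ = heptagon-path (proj₂ (proj₂ (closing k))) (proj₂ (proj₂ (closing k′))) same
      in extension-≡ x≡ w≡ y≡

    toCycle-surjective : ∀ c → ∃ λ k → toCycle k ≈ c
    toCycle-surjective c with x , w , y , p , q , h@((x~u , x≢v) , _ , (v~w , v≢y) , (w~y , _) , _) , same ← through c
      with j , refl ← complete W v~w (≢-sym (proj₂ (proj₁ (proj₂ h))))
      with s , refl ← complete X (Adj-sym x~u) x≢v
      with t , refl ← complete (Y j) w~y (≢-sym v≢y) =
        -- The closing vertices stored in `toCycle k` come from the search in `good?`; by
        -- `closing-unique` they are those of the given cycle.
        k , ≈-sym {c} {toCycle k}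
          (subst₂ (λ p q → SameEdges (proj₁ c) (_ ∷ _ ∷ _ ∷ _ ∷ _ ∷ p ∷ q ∷ [])) (proj₁ e) (proj₂ e) same)
      where
      k = j , s , t , fromWitness (p , q , h)
      e = closing-unique h (proj₂ (proj₂ (closing k)))

    Extension↔Fin : Extension ↔ Fin 6
    Extension↔Fin = mk↔ₛ′ (λ k → C.from (toCycle k)) (λ i → proj₁ (toCycle-surjective (C.to i)))
      (λ i → trans (C.from-cong (proj₂ (toCycle-surjective (C.to i)))) (C.strictlyInverseʳ i))
      (λ k → toCycle-injective _ _
        (≈-trans {toCycle (proj₁ (toCycle-surjective (C.to (C.from (toCycle k)))))} {C.to (C.from (toCycle k))} {toCycle k}
          (proj₂ (toCycle-surjective (C.to (C.from (toCycle k))))) (C.strictlyInverseˡ (toCycle k))))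
      where module C = Inverse (cyclesPerEdge u~v)

    edge-count : total (λ j → total λ s → total λ t → bit (good (branch X s) u v (branch W j) (branch (Y j) t))) ≡ 6
    edge-count = ↔⇒≡ (↔-trans (↔-sym (Σ↔Fin λ j → Σ↔Fin λ s → Σ↔Fin λ t → T↔Fin _)) Extension↔Fin)

  heptagon-rotate : ∀ {c₀ c₁ c₂ c₃ c₄ c₅ c₆} → Heptagon c₀ c₁ c₂ c₃ c₄ c₅ c₆ → Heptagon c₁ c₂ c₃ c₄ c₅ c₆ c₀
  heptagon-rotate (d₀ , d₁ , d₂ , d₃ , d₄ , d₅ , d₆ , _) = d₁ , d₂ , d₃ , d₄ , d₅ , d₆ , d₀ , (proj₁ d₁ , tt) , tt , tt

  good-reverse : ∀ {x u v w y} → Good x u v w y → Good y w v u x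
  good-reverse (p , q , h) = q , p , heptagon-reverse (heptagon-rotate h)

  good-sym : ∀ x u v w y → good x u v w y ≡ good y w v u x
  good-sym x u v w y with good? x u v w y | good? y w v u x
  ... | yes _ | yes _ = refl
  ... | no _  | no _  = refl
  ... | yes g | no ¬g = contradiction (good-reverse g) ¬g
  ... | no ¬g | yes g = contradiction (good-reverse g) ¬g

  total-swap : ∀ (f : Bool → Bool → ℕ) → total (λ s → total (f s)) ≡ total (λ t → total λ s → f s t)
  total-swap f = shuffle (f false false) (f false true) (f true false) (f true true)
    where
    shuffle : ∀ a b c d → (a + b) + (c + d) ≡ (a + c) + (b + d)
    shuffle = solve-∀

  total-cong : ∀ {f g : Bool → ℕ} → (∀ b → f b ≡ g b) → total f ≡ total g
  total-cong eq = cong₂ _+_ (eq false) (eq true)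

  among : ∀ {u v a b y} → Fork u v → Adj u a → a ≢ v → Adj u b → b ≢ v → a ≢ b → Adj u y → y ≢ v → y ≡ a ⊎ y ≡ b
  among F u~a a≢v u~b b≢v a≢b u~y y≢v with Fork.complete F u~a a≢v | Fork.complete F u~b b≢v | Fork.complete F u~y y≢v
  ... | false , refl | false , refl | _ = contradiction refl a≢b
  ... | true  , refl | true  , refl | _ = contradiction refl a≢b
  ... | false , refl | true , refl | false , refl = inj₁ refl
  ... | false , refl | true , refl | true , refl = inj₂ refl
  ... | true , refl | false , refl | true , refl = inj₁ refl
  ... | true , refl | false , refl | false , refl = inj₂ refl

  record Ends (x u v w y : V) : Set where
    constructor ends
    field
      start  : Adj u x
      start≢ : x ≢ v
      finish : Adj w y
      finish≢ : y ≢ v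

  -- The first branch is `u`, which fixes the order of the summands when `edge-count` is applied to
  -- the other edges at `v`.
  fork-at : ∀ {u v} (W : Fork v u) → Adj v u → ∀ s → Fork v (Fork.branch W s)
  fork-at {u} {v} W v~u s = record
    { branch   = both u (branch (not s))
    ; adjacent = both v~u (adjacent (not s))
    ; forward  = both (≢-sym (forward s)) (λ eq → not-fixed s (injective eq))
    ; split    = ≢-sym (forward (not s))
    ; complete = complete′
    }
    where
    open Fork W
    not-fixed : ∀ s → not s ≢ s
    not-fixed false ()
    not-fixed true ()
    flip : ∀ {s t} → t ≢ s → t ≡ not s
    flip {false} {false} n = contradiction refl n
    flip {false} {true} n = refl
    flip {true} {false} n = refl
    flip {true} {true} n = contradiction refl n
    complete′ : ∀ {y} → Adj v y → y ≢ branch s → ∃ λ t → y ≡ both u (branch (not s)) t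
    complete′ {y} v~y y≢ with y ≟ u
    ... | yes y≡u = false , y≡u
    ... | no y≢u with t , refl ← complete v~y y≢u = true , cong branch (flip (y≢ ∘ cong branch))

  module _ {v : V} where
    goods : ∀ {a b} → Adj a v → Adj b v → ℕ
    goods {a} {b} a~v b~v = total λ s → total λ t → bit (good (Fork.branch (fork a~v) s) a v b (Fork.branch (fork b~v) t))

    goods-sym : ∀ {a b} (a~v : Adj a v) (b~v : Adj b v) → goods a~v b~v ≡ goods b~v a~v
    goods-sym {a} {b} a~v b~v = trans
      (total-swap λ s t → bit (good (x s) a v b (y t)))
      (total-cong {λ t → total λ s → bit (good (x s) a v b (y t))} {λ t → total λ s → bit (good (y t) b v a (x s))} λ t →
        total-cong {λ s → bit (good (x s) a v b (y t))} {λ s → bit (good (y t) b v a (x s))} λ s →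
          cong bit (good-sym (x s) a v b (y t)))
      where
      x = Fork.branch (fork a~v)
      y = Fork.branch (fork b~v)

    -- Each of the three edges at `v` gives an equation saying that the counts for the two pairs
    -- containing it add up to 6; `thirds` solves them.
    goods-three : ∀ {u} (u~v : Adj u v) (W : Fork v u) s → goods u~v (Adj-sym (Fork.adjacent W s)) ≡ 3
    goods-three u~v W = both (thirds (goods u~v b₀) (goods u~v b₁) (goods b₀ b₁) at-u at-b₀ at-b₁)
      (thirds (goods u~v b₁) (goods u~v b₀) (goods b₀ b₁) (trans (+-comm (goods u~v b₁) (goods u~v b₀)) at-u) at-b₁ at-b₀)
      where
      open Fork W
      b₀ = Adj-sym (adjacent false)
      b₁ = Adj-sym (adjacent true)
      W₀ = fork-at W (Adj-sym u~v) false
      W₁ = fork-at W (Adj-sym u~v) true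
      at-u : goods u~v b₀ + goods u~v b₁ ≡ 6
      -- The outermost `total` unfolds to the sum over the two branches of `W`.
      at-u = edge-count u~v (fork u~v) W (λ s → fork (Adj-sym (adjacent s)))
      at-b₀ : goods u~v b₀ + goods b₀ b₁ ≡ 6
      at-b₀ = trans (cong (_+ goods b₀ b₁) (goods-sym u~v b₀))
        (edge-count b₀ (fork b₀) W₀ (both {λ j → Fork (Fork.branch W₀ j) v} (fork u~v) (fork b₁)))
      at-b₁ : goods u~v b₁ + goods b₀ b₁ ≡ 6
      at-b₁ = trans (cong₂ _+_ (goods-sym u~v b₁) (goods-sym b₀ b₁))
        (edge-count b₁ (fork b₁) W₁ (both {λ j → Fork (Fork.branch W₁ j) v} (fork u~v) (fork b₀)))

  good-false⁻ : ∀ {x u v w y} → good x u v w y ≡ false → ¬ Good x u v w y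
  good-false⁻ {x} {u} {v} {w} {y} eq with no ¬g ← good? x u v w y = ¬g

  good-false⁺ : ∀ {x u v w y} → ¬ Good x u v w y → good x u v w y ≡ false
  good-false⁺ {x} {u} {v} {w} {y} ¬g with good? x u v w y
  ... | yes g = contradiction g ¬g
  ... | no _  = refl

  UniqueBad : (u v w : V) → Set
  UniqueBad u v w = ∃ λ x → ∃ λ y → Ends x u v w y × ¬ Good x u v w y ×
                    (∀ {x′ y′} → Ends x′ u v w y′ → ¬ Good x′ u v w y′ → x′ ≡ x × y′ ≡ y)

  unique-bad : ∀ {u v w} (X : Fork u v) (Y : Fork w v) →
               total (λ s → total λ t → bit (good (Fork.branch X s) u v w (Fork.branch Y t))) ≡ 3 → UniqueBad u v w
  unique-bad {u} {v} {w} X Y three with s , t , bad , only ← unique-false _ three =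
    branch X s , branch Y t , ends (adjacent X s) (forward X s) (adjacent Y t) (forward Y t) , good-false⁻ bad , only′ only
    where
    open Fork
    only′ : ∀ {s t} → (∀ {s′ t′} → good (branch X s′) u v w (branch Y t′) ≡ false → s′ ≡ s × t′ ≡ t) →
            ∀ {x′ y′} → Ends x′ u v w y′ → ¬ Good x′ u v w y′ → x′ ≡ branch X s × y′ ≡ branch Y t
    only′ only (ends u~x x≢v w~y y≢v) ¬g with s′ , refl ← complete X u~x x≢v | t′ , refl ← complete Y w~y y≢v
      with refl , refl ← only (good-false⁺ ¬g) = refl , refl

  bad-unique : ∀ {u v w} → Adj u v → Adj v w → u ≢ w → UniqueBad u v w
  bad-unique {u} {v} {w} u~v v~w u≢w = at-branch (Fork.complete W v~w (≢-sym u≢w))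
    where
    W = fork (Adj-sym u~v)
    at-branch : (∃ λ s → w ≡ Fork.branch W s) → UniqueBad u v w
    at-branch (s , refl) = unique-bad (fork u~v) (fork (Adj-sym (Fork.adjacent W s))) (goods-three u~v W s)

  -- Straight paths

  Straight : (x u v w : V) → Set
  Straight x u v w = ∃ λ y → Adj w y × y ≢ v × ¬ Good x u v w y

  Path : (x u v w : V) → Set
  Path x u v w = Walk (x ∷ u ∷ v ∷ w ∷ [])

  path : ∀ {x u v w} → Adj x u → x ≢ v → Adj u v → u ≢ w → Adj v w → Path x u v w
  path xu xv uv uw vw = (xu , xv) , (uv , uw) , (vw , tt) , tt , tt

  reverse-path : ∀ {a b c d} → Path a b c d → Path d c b a
  reverse-path ((ab , ac) , (bc , bd) , (cd , _) , _) = path (Adj-sym cd) (≢-sym bd) (Adj-sym bc) (≢-sym ac) (Adj-sym ab)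

  straight-exists : ∀ {u v w} → Adj u v → Adj v w → u ≢ w → ∃ λ x → Adj u x × x ≢ v × Straight x u v w
  straight-exists u~v v~w u≢w with x , y , ends u~x x≢v w~y y≢v , ¬g , _ ← bad-unique u~v v~w u≢w = x , u~x , x≢v , y , w~y , y≢v , ¬g

  straight-unique : ∀ {x x′ u v w} → Path x u v w → Path x′ u v w → Straight x u v w → Straight x′ u v w → x ≡ x′
  straight-unique ((x~u , x≢v) , (u~v , u≢w) , (v~w , _) , _) ((x′~u , x′≢v) , _) (y , w~y , y≢v , ¬g) (y′ , w~y′ , y′≢v , ¬g′)
    with _ , _ , _ , _ , only ← bad-unique u~v v~w u≢w =
    trans (proj₁ (only (ends (Adj-sym x~u) x≢v w~y y≢v) ¬g)) (sym (proj₁ (only (ends (Adj-sym x′~u) x′≢v w~y′ y′≢v) ¬g′)))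

  -- If both extensions at one end lie on heptagons, these leave the other end by different
  -- edges, for otherwise they would close up to a cycle of length at most six.
  straight-reverse : ∀ {x u v w} → Path x u v w → Straight x u v w → Straight w v u x
  straight-reverse {x} {u} {v} {w} ((x~u , x≢v) , (u~v , u≢w) , (v~w , _) , _) (y , w~y , y≢v , ¬g)
    with good? w v u x (branch false) | good? w v u x (branch true)
    where open Fork (fork x~u)
  ... | no ¬g₀ | _ = _ , Fork.adjacent (fork x~u) false , Fork.forward (fork x~u) false , ¬g₀
  ... | yes _ | no ¬g₁ = _ , Fork.adjacent (fork x~u) true , Fork.forward (fork x~u) true , ¬g₁
  ... | yes (p , q , h) | yes (p′ , q′ , h′) with q ≟ q′ | p ≟ p′
  ...   | no q≢q′ | _ with h@(_ , _ , _ , _ , _ , _ , (q~w , q≢v) , _) ← h | h′@(_ , _ , _ , _ , _ , _ , (q′~w , q′≢v) , _) ← h′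
      with among (fork (Adj-sym v~w)) (Adj-sym q~w) q≢v (Adj-sym q′~w) q′≢v q≢q′ w~y y≢v
  ...     | inj₁ refl = contradiction (_ , _ , heptagon-reverse h) ¬g
  ...     | inj₂ refl = contradiction (_ , _ , heptagon-reverse h′) ¬g
  straight-reverse {x} {u} {v} {w} ((x~u , _) , _) _
      | yes (p , _ , _ , _ , _ , (x~z , x≢p) , (z~p , _) , _) | yes (p , _ , _ , _ , _ , (x~z′ , _) , (z′~p , _) , _) | yes refl | yes refl =
      contradiction (there (there (there (here refl)))) (no-return x (branch false ∷ p ∷ branch true ∷ x ∷ [])
        ((x~z , x≢p) , (z~p , split) , (Adj-sym z′~p , ≢-sym x≢p) , (Adj-sym x~z′ , tt) , tt , tt))
    where open Fork (fork x~u)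
  straight-reverse {x} {u} {v} {w} ((x~u , _) , _) _
      | yes (p , q , _ , _ , _ , (x~z , x≢p) , (z~p , z≢q) , (p~q , _) , _)
      | yes (p′ , q , _ , _ , _ , (x~z′ , x≢p′) , (z′~p′ , z′≢q) , (p′~q , _) , _)
      | yes refl | no p≢p′ =
      contradiction (there (there (there (there (there (here refl)))))) (no-return x (branch false ∷ p ∷ q ∷ p′ ∷ branch true ∷ x ∷ [])
        ((x~z , x≢p) , (z~p , z≢q) , (p~q , p≢p′) , (Adj-sym p′~q , ≢-sym z′≢q) , (Adj-sym z′~p′ , ≢-sym x≢p′) , (Adj-sym x~z′ , tt) , tt , tt))
    where open Fork (fork x~u)

  module _ {x u v w y} (P : Walk (x ∷ u ∷ v ∷ w ∷ y ∷ [])) where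
    private
      path₂ : Path u v w y
      path₂ = proj₂ P
      w~y = proj₁ (proj₁ (proj₂ (proj₂ (proj₂ P))))
      v≢y = proj₂ (proj₁ (proj₂ (proj₂ P)))
      x~u = proj₁ (proj₁ P)
      x≢v = proj₂ (proj₁ P)

    bad⇒straight : ¬ Good x u v w y → Straight x u v w × Straight u v w y
    bad⇒straight ¬g = (y , w~y , ≢-sym v≢y , ¬g) ,
      straight-reverse (reverse-path path₂) (x , Adj-sym x~u , x≢v , ¬g ∘ good-reverse)

    -- A bad extension `y′` makes `y′ w v u` straight, and reversal makes `y w v u` straight; as
    -- straight extensions are unique, `y′` is `y`.
    straight⇒bad : Straight x u v w → Straight u v w y → ¬ Good x u v w y
    straight⇒bad (y′ , w~y′ , y′≢v , ¬g) s = subst (λ y → ¬ Good x u v w y) y′≡y ¬g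
      where
      y′≡y : y′ ≡ y
      y′≡y = straight-unique
        (path (Adj-sym w~y′) y′≢v (Adj-sym (proj₁ (proj₁ (proj₂ (proj₂ P))))) (≢-sym (proj₂ (proj₁ (proj₂ P)))) (Adj-sym (proj₁ (proj₁ (proj₂ P)))))
        (reverse-path path₂) (x , Adj-sym x~u , x≢v , ¬g ∘ good-reverse) (straight-reverse path₂ s)

  -- The action on flags

  Frame : (u a v c : V) → Set
  Frame u a v c = (Adj u a × Adj u v × Adj u c) × a ≢ v × v ≢ c × c ≢ a

  frame? : ∀ u a v c → Dec (Frame u a v c)
  frame? u a v c = (adj? u a ×-dec adj? u v ×-dec adj? u c) ×-dec ¬? (a ≟ v) ×-dec ¬? (v ≟ c) ×-dec ¬? (c ≟ a)

  -- A vertex with an ordering of its three neighbours; the frame is irrelevant so that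
  -- flags are equal as soon as their vertices are.
  record Flag : Set where
    constructor flag
    field
      centre into out side : V
      .valid : Frame centre into out side

  open Flag

  frame : ∀ p → Frame (centre p) (into p) (out p) (side p)
  frame (flag u a v c f) = recompute (frame? u a v c) f

  rotateFlag : Turn → Flag → Flag
  rotateFlag t p .centre = centre p
  rotateFlag t p .into   = pick t (side p) (out p)
  rotateFlag t p .out    = pick t (into p) (side p)
  rotateFlag t p .side   = pick t (out p) (into p)
  rotateFlag left  p .valid = let (a , b , c) , ab , bc , ca = frame p in (c , a , b) , ca , ab , bc
  rotateFlag right p .valid = let (a , b , c) , ab , bc , ca = frame p in (b , c , a) , bc , ca , ab

  mirrorFlag : Flag → Flag
  mirrorFlag (flag u a v c f) = flag u c v a (let (a~ , v~ , c~) , av , vc , ca = f in (c~ , v~ , a~) , ≢-sym vc , ≢-sym av , ≢-sym ca)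

  -- `far` continues the face along `into`, `centre`, `out`; `near` is then left for the face on the
  -- other side of the edge.
  record Crossing (p : Flag) : Set where
    field
      near far    : V
      near-adj    : Adj (out p) near
      near≢       : near ≢ centre p
      far-adj     : Adj (out p) far
      far≢        : far ≢ centre p
      near≢far    : near ≢ far
      far-straight : Straight far (out p) (centre p) (into p)

  abstract
    crossing : ∀ p → Crossing p
    crossing p@record{ centre = u ; into = a ; out = v } with (u~a , u~v , _) , a≢v , _ ← frame p
      with b′ , v~b′ , b′≢u , straight ← straight-exists (Adj-sym u~v) u~a (≢-sym a≢v)
      with s , refl ← Fork.complete (fork (Adj-sym u~v)) v~b′ b′≢u = record
        { near = branch (not s) ; far = branch s
        ; near-adj = adjacent (not s) ; near≢ = forward (not s)
        ; far-adj = adjacent s ; far≢ = forward s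
        ; near≢far = not-fixed s ∘ injective
        ; far-straight = straight }
        where
        open Fork (fork (Adj-sym u~v))
        not-fixed : ∀ s → not s ≢ s
        not-fixed false ()
        not-fixed true ()

  open Crossing

  crossFlag : Flag → Flag
  crossFlag p = flag (out p) (near (crossing p)) (centre p) (far (crossing p))
    (let c = crossing p in (near-adj c , Adj-sym (proj₁ (proj₂ (proj₁ (frame p)))) , far-adj c) , near≢ c , ≢-sym (far≢ c) , ≢-sym (near≢far c))

  -- A relational description of `crossFlag`. It determines the second flag, is symmetric and
  -- commutes with mirroring, from which the equations for `crossFlag` follow.
  Crosses : Flag → Flag → Set
  Crosses (flag u a v c _) (flag v′ b u′ b′ _) = v′ ≡ v × u′ ≡ u × Straight b′ v u a

  crosses-cross : ∀ p → Crosses p (crossFlag p)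
  crosses-cross p = refl , refl , far-straight (crossing p)

  side-path : ∀ {p q} → Crosses p q → Path (side q) (out p) (centre p) (into p)
  side-path {p} {q} (refl , refl , _) with (u~a , u~v , _) , a≢v , _ ← frame p | (v~b , _ , v~b′) , _ , u≢b′ , _ ← frame q =
    path (Adj-sym v~b′) (≢-sym u≢b′) (Adj-sym u~v) (≢-sym a≢v) u~a

  crosses-unique : ∀ {p q q′} → Crosses p q → Crosses p q′ → q ≡ q′
  crosses-unique {p} {q} {q′} c@(refl , refl , s) c′@(refl , refl , s′)
    with straight-unique (side-path {p} {q} c) (side-path {p} {q′} c′) s s′
  ... | refl with (v~b , v~u , v~c) , b≢u , u≢c , c≢b ← frame q | (v~b′ , _ , _) , b′≢u , _ , c≢b′ ← frame q′
    with among (fork v~u) v~b b≢u v~c (≢-sym u≢c) (≢-sym c≢b) v~b′ b′≢u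
  ...   | inj₁ refl = refl
  ...   | inj₂ b′≡c = contradiction (sym b′≡c) c≢b′

  -- The straight extension at `u` of the path from `into q` must be `side p`: if it were `into p`,
  -- then `into q` and `side q` would both be straight extensions of the same path.
  crosses-sym : ∀ {p q} → Crosses p q → Crosses q p
  crosses-sym {p} {q} c@(refl , refl , s)
    with (u~a , u~v , u~c) , a≢v , v≢c , c≢a ← frame p | (v~b , v~u , v~b′) , b≢u , u≢b′ , b′≢b ← frame q
    with x , u~x , x≢v , t ← straight-exists u~v v~b (≢-sym b≢u)
    with among (fork u~v) u~a a≢v u~c (≢-sym v≢c) (≢-sym c≢a) u~x x≢v
  ... | inj₂ refl = refl , refl , t
  ... | inj₁ refl = contradiction (straight-unique (side-path {p} {q} c) (reverse-path there-path) s (straight-reverse there-path t)) b′≢b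
    where there-path = path (Adj-sym u~a) a≢v u~v (≢-sym b≢u) v~b

  crosses-mirror : ∀ {p q} → Crosses p q → Crosses (mirrorFlag p) (mirrorFlag q)
  crosses-mirror {p} {q} c@(refl , refl , _) with c′@(_ , _ , t) ← crosses-sym {p} {q} c =
    refl , refl , straight-reverse (side-path {q} {p} c′) t

  mirror-cross : ∀ p → crossFlag (mirrorFlag p) ≡ mirrorFlag (crossFlag p)
  mirror-cross p = crosses-unique {mirrorFlag p} (crosses-cross (mirrorFlag p)) (crosses-mirror {p} {crossFlag p} (crosses-cross p))

  cross-involutive : ∀ p → crossFlag (crossFlag p) ≡ p
  cross-involutive p = crosses-unique {crossFlag p} (crosses-cross (crossFlag p)) (crosses-sym {p} {crossFlag p} (crosses-cross p))

  flags : Action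
  flags = record
    { Flag    = Flag
    ; act     = λ { cross → crossFlag ; (turn t) → rotateFlag t ; mirror → mirrorFlag }
    ; cross²  = cross-involutive
    ; mirror² = λ _ → refl
    ; turn²   = λ { left _ → refl ; right _ → refl }
    ; turn⁻¹  = λ { left _ → refl ; right _ → refl }
    ; cross-mirror = mirror-cross
    ; turn-mirror  = λ { left _ → refl ; right _ → refl }
    }

  open Runs flags public

  -- Turns and walks

  advance : Turn → Flag → Flag
  advance t p = rotateFlag t (crossFlag p)

  out-advance : ∀ t p → Adj (out p) (out (advance t p)) × out (advance t p) ≢ centre p
  out-advance left  p = near-adj (crossing p) , near≢ (crossing p)
  out-advance right p = far-adj (crossing p) , far≢ (crossing p)

  centre~out : ∀ p → Adj (centre p) (out p)
  centre~out p = proj₁ (proj₂ (proj₁ (frame p)))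

  path-advance : ∀ t t′ p → Path (centre p) (out p) (out (advance t p)) (out (advance t′ (advance t p)))
  path-advance t t′ p = path (centre~out p) (≢-sym (proj₂ (out-advance t p))) (proj₁ (out-advance t p))
    (≢-sym (proj₂ (out-advance t′ (advance t p)))) (proj₁ (out-advance t′ (advance t p)))

  -- After a right turn, `into` is the vertex just left, so the straight continuation `far` is again
  -- a right turn; left turns are the mirror image.
  straight-advance : ∀ t p → Straight (centre p) (out p) (out (advance t p)) (out (advance t (advance t p)))
  straight-advance left p = straight-reverse (side-path {mirrorFlag q} {mirrorFlag (crossFlag q)} c) (proj₂ (proj₂ c))
    where
    q = advance left p
    c = crosses-mirror {q} {crossFlag q} (crosses-cross q)
  straight-advance right p = straight-reverse (side-path {q} {crossFlag q} c) (proj₂ (proj₂ c))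
    where
    q = advance right p
    c = crosses-cross q

  -- Repeating `t` already gives the unique straight continuation.
  straight-turns : ∀ t t′ p → Straight (centre p) (out p) (out (advance t p)) (out (advance t′ (advance t p))) → t ≡ t′
  straight-turns t t′ p s = out-injective t t′ (straight-unique
      (reverse-path (path-advance t t p)) (reverse-path (path-advance t t′ p))
      (straight-reverse (path-advance t t p) (straight-advance t p)) (straight-reverse (path-advance t t′ p) s))
    where
    out-injective : ∀ {q} t t′ → out (advance t q) ≡ out (advance t′ q) → t ≡ t′
    out-injective left  left  _ = refl
    out-injective right right _ = refl
    out-injective {q} left right eq = contradiction eq (near≢far (crossing q))
    out-injective {q} right left eq = contradiction (sym eq) (near≢far (crossing q))

  onward : Flag → (ts : List Turn) → Vec V (length ts)
  onward p []       = []
  onward p (t ∷ ts) = out p ∷ onward (advance t p) ts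

  onward-walk : ∀ p ts → Walk (centre p ∷ onward p ts)
  onward-walk p []           = tt , tt
  onward-walk p (t ∷ [])     = (centre~out p , tt) , tt , tt
  onward-walk p (t ∷ t′ ∷ ts) = (centre~out p , ≢-sym (proj₂ (out-advance t p))) , onward-walk (advance t p) (t′ ∷ ts)

  destination : ∀ p t ts → centre (run (route (t ∷ ts)) p) ∈ onward p (t ∷ ts)
  destination p t []        = here refl
  destination p t (t′ ∷ ts) = there (destination (advance t p) t′ ts)

  Returns : Flag → List Turn → Set
  Returns p ts = centre (run (route ts) p) ≡ centre p

  short-open : ∀ t ts → length ts < 6 → ∀ p → ¬ Returns p (t ∷ ts)
  short-open t ts short p r = All.lookup (walk-open (proj₂ girth) (centre p) (onward p (t ∷ ts)) short (onward-walk p (t ∷ ts)))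
    (destination p t ts) (sym r)

  returns-heptagon : ∀ p t₁ t₂ t₃ t₄ t₅ t₆ t₇ → Returns p (t₁ ∷ t₂ ∷ t₃ ∷ t₄ ∷ t₅ ∷ t₆ ∷ t₇ ∷ []) →
                     let p₁ = advance t₁ p; p₂ = advance t₂ p₁; p₃ = advance t₃ p₂ in
                     Good (centre p) (out p) (out p₁) (out p₂) (out p₃)
  returns-heptagon p t₁ t₂ t₃ t₄ t₅ t₆ t₇ r = out p₄ , out p₅ , close (onward-walk p (t₁ ∷ t₂ ∷ t₃ ∷ t₄ ∷ t₅ ∷ t₆ ∷ t₇ ∷ [])) r
    where
    p₁ = advance t₁ p; p₂ = advance t₂ p₁; p₃ = advance t₃ p₂; p₄ = advance t₄ p₃; p₅ = advance t₅ p₄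
    close : ∀ {c₀ c₁ c₂ c₃ c₄ c₅ c₆ c₇} → Walk (c₀ ∷ c₁ ∷ c₂ ∷ c₃ ∷ c₄ ∷ c₅ ∷ c₆ ∷ c₇ ∷ []) → c₇ ≡ c₀ → Heptagon c₀ c₁ c₂ c₃ c₄ c₅ c₆
    close {c₁ = c₁} {c₂} {c₃} {c₄} {c₅} {c₆} (d₀ , d₁ , d₂ , d₃ , d₄ , d₅ , (a₆₀ , _) , _) refl =
      -- Only backtracking at `c₀` remains to be excluded: `c₆` equal to `c₁` would close a walk of
      -- five steps.
      d₀ , d₁ , d₂ , d₃ , d₄ , d₅ , (a₆₀ , λ { refl → no-return c₁ (c₂ ∷ c₃ ∷ c₄ ∷ c₅ ∷ c₆ ∷ [])
        (d₁ , d₂ , d₃ , d₄ , (proj₁ d₅ , tt) , tt , tt) (there (there (there (there (here refl))))) }) , (proj₁ d₀ , tt) , tt , tt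

  walk₅ : ∀ t₁ t₂ t₃ p → let p₁ = advance t₁ p; p₂ = advance t₂ p₁; p₃ = advance t₃ p₂ in
          Walk (centre p ∷ out p ∷ out p₁ ∷ out p₂ ∷ out p₃ ∷ [])
  -- The last turn does not affect the vertices listed by `onward`, so `left` is arbitrary.
  walk₅ t₁ t₂ t₃ p = onward-walk p (t₁ ∷ t₂ ∷ t₃ ∷ left ∷ [])

  straight-open : ∀ ts → length ts ≡ 7 → T (straight ts) → ∀ p → ¬ Returns p ts
  straight-open (t₁ ∷ t₂ ∷ t₃ ∷ t₄ ∷ t₅ ∷ t₆ ∷ t₇ ∷ []) refl s p r
    with same₁ , same₂ ← to T-∧ s with refl ← same-sound {t₁} {t₂} same₁ | refl ← same-sound {t₂} {t₃} same₂ =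
    straight⇒bad (walk₅ t₁ t₁ t₁ p) (straight-advance t₁ p) (straight-advance t₁ (advance t₁ p))
      (returns-heptagon p t₁ t₁ t₁ t₄ t₅ t₆ t₇ r)

  straight-unfixed : ∀ ts → length ts ≡ 7 → T (straight ts) → ∀ p → run (route ts) p ≢ p × run (route ts) (mirrorFlag p) ≢ p
  straight-unfixed ts seven s p = straight-open ts seven s p ∘ cong centre , straight-open ts seven s (mirrorFlag p) ∘ cong centre

  follow : ∀ p {z} → Adj (out p) z → z ≢ centre p → ∃ λ t → out (advance t p) ≡ z
  follow p o~z z≢ with among (fork (Adj-sym (centre~out p))) (near-adj c) (near≢ c) (far-adj c) (far≢ c) (near≢far c) o~z z≢
    where c = crossing p
  ... | inj₁ eq = left , sym eq
  ... | inj₂ eq = right , sym eq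

  same-edge : ∀ p q → centre p ≡ centre q → out p ≡ out q → p ≡ q ⊎ mirrorFlag p ≡ q
  same-edge p q refl refl with (u~a , u~v , u~c) , a≢v , v≢c , c≢a ← frame p | (u~a′ , _ , u~c′) , a′≢v , v≢c′ , c′≢a′ ← frame q
    with among (fork u~v) u~a a≢v u~c (≢-sym v≢c) (≢-sym c≢a) u~a′ a′≢v
       | among (fork u~v) u~a a≢v u~c (≢-sym v≢c) (≢-sym c≢a) u~c′ (≢-sym v≢c′)
  ... | inj₁ refl | inj₂ refl = inj₁ refl
  ... | inj₂ refl | inj₁ refl = inj₂ refl
  ... | inj₁ refl | inj₁ refl = contradiction refl c′≢a′
  ... | inj₂ refl | inj₂ refl = contradiction refl c′≢a′

  Meets : Flag → Flag → Set
  Meets q p = q ≡ p ⊎ mirrorFlag q ≡ p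

  -- This and its successors turn a walk leading from `q` to the directed edge of `p` into turns.
  -- Flags on the same directed edge agree up to `mirrorFlag`.
  meet₁ : ∀ p q → out q ≡ centre p → out p ≢ centre q → ∃ λ t → Meets (advance t q) p
  meet₁ p q eq n = let t , eq′ = follow q (subst (λ z → Adj z (out p)) (sym eq) (centre~out p)) n 
                 in t , same-edge (advance t q) p eq eq′

  meet₂ : ∀ p q → Adj (out q) (centre p) → centre p ≢ centre q → out p ≢ out q →
          ∃ λ t → ∃ λ t′ → Meets (advance t′ (advance t q)) p
  meet₂ p q a n n′ =
    let t , eq = follow q a n
        t′ , meets = meet₁ p (advance t q) eq n′
    in t , t′ , meets

  meet₃ : ∀ p q {x} → Adj (out q) x → x ≢ centre q → Adj x (centre p) → centre p ≢ out q → out p ≢ x →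
          ∃ λ t → ∃ λ t′ → ∃ λ t″ → Meets (advance t″ (advance t′ (advance t q))) p
  meet₃ p q a n a′ n′ n″ =
    let t , eq = follow q a n
        t′ , t″ , meets = meet₂ p (advance t q) (subst (λ z → Adj z (centre p)) (sym eq) a′) n′ (λ eq′ → n″ (trans eq′ eq))
    in t , t′ , t″ , meets

  meet₄ : ∀ p q {x y} → Adj (out q) x → x ≢ centre q → Adj x y → y ≢ out q → Adj y (centre p) → centre p ≢ x → out p ≢ y →
          ∃ λ t → ∃ λ t′ → ∃ λ t″ → ∃ λ t‴ → Meets (advance t‴ (advance t″ (advance t′ (advance t q)))) p
  meet₄ p q {y = y} a n a′ n′ a″ n″ n‴ =
    let t , eq = follow q a n
        t′ , t″ , t‴ , meets = meet₃ p (advance t q) (subst (λ z → Adj z y) (sym eq) a′) n′ a″ (λ eq′ → n″ (trans eq′ eq)) n‴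
    in t , t′ , t″ , t‴ , meets

  bent-turns : ∀ {t₁ t₂ t₃} → t₁ ≡ t₂ → t₂ ≡ t₃ → ¬ T (not (straight (t₁ ∷ t₂ ∷ t₃ ∷ [])))
  bent-turns {left}  refl refl ()
  bent-turns {right} refl refl ()

  -- Were the path bad, both subpaths of length 3 would be straight, making all three turns equal.
  bent-good : ∀ p t₁ t₂ t₃ → T (not (straight (t₁ ∷ t₂ ∷ t₃ ∷ []))) →
              let p₁ = advance t₁ p; p₂ = advance t₂ p₁; p₃ = advance t₃ p₂ in
              Good (centre p) (out p) (out p₁) (out p₂) (out p₃)
  bent-good p t₁ t₂ t₃ bent = decidable-stable (good? _ _ _ _ _) λ ¬g →
    let s₁ , s₂ = bad⇒straight (walk₅ t₁ t₂ t₃ p) ¬g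
    in bent-turns (straight-turns t₁ t₂ p s₁) (straight-turns t₂ t₃ (advance t₁ p) s₂) bent

  -- From `out q` the walk passes the two closing vertices, then `centre p`, and heads for `out p`:
  -- four turns.
  good-closes : ∀ p q {u v} → Good (centre p) u v (centre q) (out q) → out p ≡ u →
                ∃ λ t → ∃ λ t′ → ∃ λ t″ → ∃ λ t‴ → Meets (advance t‴ (advance t″ (advance t′ (advance t q)))) p
  good-closes p q (_ , _ , _ , _ , _ , (_ , n₃₅) , (a₄₅ , n₄₆) , (a₅₆ , n₅₀) , (a₆₀ , n₆₁) , _) refl =
    meet₄ p q a₄₅ (≢-sym n₃₅) a₅₆ (≢-sym n₄₆) a₆₀ (≢-sym n₅₀) (≢-sym n₆₁)

  closable : Closable
  closable p t₁ t₂ t₃ bent = good-closes p (advance t₃ (advance t₂ (advance t₁ p))) (bent-good p t₁ t₂ t₃ bent) refl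

  -- Excluding zigzags and then all flags

  module _ {forbidden : List Turn → Bool}
           (forbidden-open : ∀ ts → length ts ≡ 7 → T (forbidden ts) → ∀ p →
                           run (route ts) p ≢ p × run (route ts) (mirrorFlag p) ≢ p) where

    rigid : Rigid forbidden
    rigid = record
      { mirror-free = λ p eq → side≢into p (cong into eq)
      ; turn-free   = λ { left  p → side≢into p ∘ cong into , out≢side p ∘ cong side
                        ; right p → into≢out p ∘ sym ∘ cong into , (λ eq → into≢out p (sym (cong into eq))) }
      ; cross-free  = λ p → (λ eq → irrefl (sym (cong centre eq)) (centre~out p)) , (λ eq → irrefl (sym (cong centre eq)) (centre~out p))
      ; legal       = legal
      }
      where
      side≢into : ∀ p → side p ≢ into p
      side≢into p = proj₂ (proj₂ (proj₂ (frame p)))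
      out≢side : ∀ p → out p ≢ side p
      out≢side p = proj₁ (proj₂ (proj₂ (frame p)))
      into≢out : ∀ p → into p ≢ out p
      into≢out p = proj₁ (proj₂ (frame p))
      legal : ∀ ts → T (Check.illegalTurns forbidden ts) → ∀ p → run (route ts) p ≢ p × run (route ts) (mirrorFlag p) ≢ p
      legal (t ∷ ts) i p with to T-∨ i
      ... | inj₁ short = short-open t ts lt p ∘ cong centre , short-open t ts lt (mirrorFlag p) ∘ cong centre
        where lt = ≤-pred (<ᵇ⇒< (length (t ∷ ts)) 7 short)
      ... | inj₂ i′ with seven , f ← to T-∧ i′ = forbidden-open (t ∷ ts) (≡ᵇ⇒≡ (length (t ∷ ts)) 7 seven) f p

  straight-rigid : Rigid straight
  straight-rigid = rigid straight-unfixed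

  refuted-sound : ∀ plan w {p} → T (refuted plan w) → ¬ Fixes p w
  refuted-sound plan w {p} r fix = Refutation.extends-sound straight-rigid closable plan w [] fix [] r

  rightZigzag-open : ∀ ts → length ts ≡ 3 → ∀ p → ¬ Fixes p (rightZigzag ts) × ¬ Fixes p (rightZigzag ts ++ mirror ∷ [])
  rightZigzag-open ts three p =
    let r₁ , r₂ = to (T-∧ {refuted (zigzagPlan ts false) (rightZigzag ts)}
                        {refuted (zigzagPlan ts true) (rightZigzag ts ++ mirror ∷ [])})
                    (everyTurns-true 3 zigzagRefuted ts three zigzags-refuted)
    in refuted-sound (zigzagPlan ts false) (rightZigzag ts) r₁ , refuted-sound (zigzagPlan ts true) (rightZigzag ts ++ mirror ∷ []) r₂

  -- Left-handed zigzags are read from the mirrored flag with opposite turns. A word taking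
  -- `mirrorFlag p` to `p` fixes `mirrorFlag p` once `mirror` is appended.
  zigzag-open : ∀ ts → length ts ≡ 7 → T (zigzag ts) → ∀ p → run (route ts) p ≢ p × run (route ts) (mirrorFlag p) ≢ p
  zigzag-open (right ∷ left ∷ right ∷ left ∷ ts@(_ ∷ _ ∷ _ ∷ [])) refl _ p =
    proj₁ (rightZigzag-open ts refl p) , proj₂ (rightZigzag-open ts refl (mirrorFlag p)) ∘ cong mirrorFlag
  zigzag-open ts@(left ∷ right ∷ left ∷ right ∷ us@(_ ∷ _ ∷ _ ∷ [])) refl _ p =
    (λ eq → proj₁ (rightZigzag-open (map opposite us) refl (mirrorFlag p)) (trans (run-opposite ts p) (cong mirrorFlag eq))) ,
    (λ eq → proj₂ (rightZigzag-open (map opposite us) refl p) (trans (cong mirrorFlag (run-opposite ts (mirrorFlag p))) eq))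

  bent-rigid : Rigid straightOrZigzag
  bent-rigid = rigid λ ts seven s p →
    [ (λ s → straight-unfixed ts seven s p) , (λ z → zigzag-open ts seven z p) ] (to (T-∨ {straight ts} {zigzag ts}) s)

  no-flag : ¬ Flag
  no-flag p = Refutation.refutes-sound bent-rigid {p} closable finalPlan [] [] (Equivalence.from T-≡ finalPlan-refutes)

  edge⇒flag : ∀ {u v} → Adj u v → Flag
  edge⇒flag {u} {v} u~v = flag u (branch false) v (branch true)
    ((adjacent false , u~v , adjacent true) , forward false , ≢-sym (forward true) , ≢-sym split)
    where open Fork (fork u~v)

  edge-free : ∀ {u v} → ¬ Adj u v
  edge-free = no-flag ∘ edge⇒flag

theorem4 : (v : ℕ) → .{{_ : NonZero v}} → ¬ EGR v 3 7 6
-- The cycle attaining the girth supplies an edge.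
theorem4 v (G , egr) with xs@(_ ∷ _ ∷ _) , record { adjacent = x~y ∷ _ } ← proj₁ (IsEdgeGirthRegular.girth egr) =
  Cubic.edge-free G egr x~y
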